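{- Let $p$ be a prime and let $K$ be a field of characteristic $p>0$ equipped with a valuation $v: K^\ast \rightarrow G$ taking values in an ordered abelian group $G$. Let $\mathcal{O}_K=\{\alpha \in K: v(\alpha) \ge 0\}$ and $\mathfrak{m}_K=\{\alpha \in K: v(\alpha) > 0\}$ be the valuation ring and its maximal ideal, and suppose that the residue field $\mathcal{O}_K/\mathfrak{m}_K$ is finite, with $q$ elements. If $f(x) = a_0 x^{n_0} + a_1 x^{n_1} + \cdots + a_k x^{n_k}$ is a polynomial with $k+1$ nonzero coefficients $a_i \in K^\ast$ (the exponents $n_0,\dots,n_k$ being distinct nonnegative integers), then $f$ has at most $q^k$ distinct zeros in $K$.
   Context: Valuations are general Krull valuations written additively: $G$ is a totally ordered abelian group, not assumed to be discrete or of rank one, $v(\alpha\beta)=v(\alpha)+v(\beta)$ and $v(\alpha+\beta)\ge\min\{v(\alpha),v(\beta)\}$, with the convention $v(0)=+\infty$. The field $K$ is not assumed complete. Zeros are counted without multiplicity. -}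

module Defs where

open import Level using (_⊔_) renaming (suc to lsuc)
open import Algebra.Bundles using (AbelianGroup; CommutativeRing)
import Algebra.Construct.NaturalChoice.Min as Min
import Algebra.Properties.Semiring.Exp as SemiringExp
import Algebra.Properties.Semiring.Mult as SemiringMult
import Algebra.Properties.Semiring.Sum as SemiringSum
import Algebra.Properties.AbelianGroup as AbelianGroupProperties
import Algebra.Properties.Ring as RingProperties
open import Data.Fin.Base using (Fin)
open import Data.List.Base using (length)
open import Data.List.Relation.Unary.All using (All)
import Data.List.Relation.Unary.Unique.Setoid as UniqueSetoid
open import Data.Nat.Base as ℕ using (ℕ)
open import Data.Nat.Divisibility using (_∣_)
open import Data.Product.Base using (Σ; ∃; _×_; _,_; proj₁; proj₂)
open import Data.Sum.Base using (inj₁; inj₂)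
open import Function.Bundles using (Bijection; Equivalence; _⇔_)
open import Relation.Binary.Bundles using (Setoid; TotalOrder)
import Relation.Binary.Construct.Add.Supremum.Equality as SupremumEquality
import Relation.Binary.Construct.Add.Supremum.NonStrict as SupremumOrder
import Relation.Binary.Construct.NonStrictToStrict as NonStrictToStrict
open import Relation.Binary.Core using (Rel)
open import Relation.Binary.PropositionalEquality.Properties using (setoid)
import Relation.Binary.Reasoning.Setoid as SetoidReasoning
open import Relation.Binary.Structures using (IsTotalOrder; IsEquivalence)
open import Relation.Nullary.Construct.Add.Supremum using (_⁺; ⊤⁺; [_])
open import Relation.Nullary.Negation.Core using (contradiction)
open import Relation.Unary using (Pred)

record Field c ℓ : Set (lsuc (c ⊔ ℓ)) where
  field
    commutativeRing : CommutativeRing c ℓ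
  open CommutativeRing commutativeRing public
  field
    1≉0        : 1# ≉ 0#
    invertible : ∀ x → x ≉ 0# → ∃ λ y → x * y ≈ 1#

HasCharacteristic : ∀ {c ℓ} → Field c ℓ → ℕ → Set ℓ
HasCharacteristic K p = ∀ n → (n · 1# ≈ 0#) ⇔ (p ∣ n)
  where
  open Field K
  open SemiringMult semiring using () renaming (_×_ to _·_)

record OrderedAbelianGroup g ℓ₁ ℓ₂ : Set (lsuc (g ⊔ ℓ₁ ⊔ ℓ₂)) where
  infix 4 _≤_
  field
    abelianGroup : AbelianGroup g ℓ₁
  open AbelianGroup abelianGroup public
    renaming (_∙_ to _+_; ε to 0#; _⁻¹ to -_)
  field
    _≤_          : Rel Carrier ℓ₂
    isTotalOrder : IsTotalOrder _≈_ _≤_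
    +-monoʳ-≤    : ∀ x {y z} → y ≤ z → x + y ≤ x + z

  open SupremumEquality _≈_ public
    using (_≈⁺_; [_]; ⊤⁺≈⊤⁺)

  totalOrder⁺ : TotalOrder g (g ⊔ ℓ₁) (g ⊔ ℓ₂)
  totalOrder⁺ = record
    { isTotalOrder = SupremumOrder.≤⁺-isTotalOrder _≤_ isTotalOrder }

  open TotalOrder totalOrder⁺ public
    using () renaming (_≤_ to _≤⁺_)
  open NonStrictToStrict _≈⁺_ _≤⁺_ public
    using () renaming (_<_ to _<⁺_)
  open Min totalOrder⁺ public
    using () renaming (_⊓_ to min)

  infixl 6 _+⁺_
  _+⁺_ : Carrier ⁺ → Carrier ⁺ → Carrier ⁺
  [ x ] +⁺ [ y ] = [ x + y ]
  [ _ ] +⁺ ⊤⁺    = ⊤⁺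
  ⊤⁺    +⁺ _     = ⊤⁺

  0⁺ : Carrier ⁺
  0⁺ = [ 0# ]

-- A map K* → G extended by v(0) = ∞, where ∞ is ⊤⁺. Since it is decidable
-- whether an element of G ⁺ is ⊤⁺, v-∞ makes _≈ 0# decidable on K; this is
-- the constructive content of extending v from K* to K. Neither surjectivity
-- onto G nor non-triviality is required.
record Valuation {c ℓ g ℓ₁ ℓ₂}
                 (K : Field c ℓ) (G : OrderedAbelianGroup g ℓ₁ ℓ₂)
                 : Set (c ⊔ ℓ ⊔ g ⊔ ℓ₁ ⊔ ℓ₂) where
  private
    module K = Field K
  open OrderedAbelianGroup G using (_≈⁺_; _≤⁺_; _+⁺_; min)
  field
    v      : K.Carrier → OrderedAbelianGroup.Carrier G ⁺
    v-cong : ∀ {x y} → x K.≈ y → v x ≈⁺ v y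
    v-∞    : ∀ x → (v x ≈⁺ ⊤⁺) ⇔ (x K.≈ K.0#)
    v-*    : ∀ x y → v (x K.* y) ≈⁺ (v x +⁺ v y)
    v-+    : ∀ x y → min (v x) (v y) ≤⁺ v (x K.+ y)

module _ {c ℓ g ℓ₁ ℓ₂}
         {K : Field c ℓ} {G : OrderedAbelianGroup g ℓ₁ ℓ₂}
         (V : Valuation K G) where

  private
    module K = Field K
    module G = OrderedAbelianGroup G
    module G⁺ = TotalOrder G.totalOrder⁺
    module ≤ = IsTotalOrder G.isTotalOrder
  open Valuation V
  open G using (_≈⁺_; _≤⁺_; _<⁺_; _+⁺_; 0⁺; [_]; ⊤⁺≈⊤⁺)

  𝒪 : Pred K.Carrier (g ⊔ ℓ₂)
  𝒪 x = 0⁺ ≤⁺ v x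

  𝔪 : Pred K.Carrier (g ⊔ ℓ₁ ⊔ ℓ₂)
  𝔪 x = 0⁺ <⁺ v x

  private
    𝔪-resp : ∀ {x y} → v x ≈⁺ v y → 𝔪 x → 𝔪 y
    𝔪-resp vx≈vy (0≤vx , 0≉vx) =
      G⁺.trans 0≤vx (G⁺.reflexive vx≈vy) ,
      λ 0≈vy → 0≉vx (G⁺.Eq.trans 0≈vy (G⁺.Eq.sym vx≈vy))

    𝔪-0 : 𝔪 K.0#
    𝔪-0 with v K.0# | Equivalence.from (v-∞ K.0#) K.refl
    ... | ⊤⁺ | _ = (0⁺ SupremumOrder.≤⊤⁺) , λ ()

    <-≤-trans : ∀ {x y z} → x <⁺ y → y ≤⁺ z → x <⁺ z
    <-≤-trans = NonStrictToStrict.<-≤-trans _≈⁺_ _≤⁺_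
      G⁺.Eq.sym G⁺.trans G⁺.antisym G⁺.≤-respʳ-≈

    𝔪-+ : ∀ {x y} → 𝔪 x → 𝔪 y → 𝔪 (x K.+ y)
    𝔪-+ {x} {y} mx my with G⁺.total (v x) (v y) | v-+ x y
    ... | inj₁ _ | vx≤ = <-≤-trans mx vx≤
    ... | inj₂ _ | vy≤ = <-≤-trans my vy≤

    x+x≈0⇒x≈0 : ∀ x → x G.+ x G.≈ G.0# → x G.≈ G.0#
    x+x≈0⇒x≈0 x eq with ≤.total G.0# x
    ... | inj₁ 0≤x = ≤.antisym
      (≤.trans (≤.reflexive (G.sym (G.identityʳ x)))
        (≤.trans (G.+-monoʳ-≤ x 0≤x) (≤.reflexive eq)))
      0≤x
    ... | inj₂ x≤0 = ≤.antisym
      x≤0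
      (≤.trans (≤.reflexive (G.sym eq))
        (≤.trans (G.+-monoʳ-≤ x x≤0) (≤.reflexive (G.identityʳ x))))

    +⁺-congˡ : ∀ {x y} z → x ≈⁺ y → (x +⁺ z) ≈⁺ (y +⁺ z)
    +⁺-congˡ [ _ ] [ x≈y ] = [ G.∙-congʳ x≈y ]
    +⁺-congˡ ⊤⁺    [ _ ]   = ⊤⁺≈⊤⁺
    +⁺-congˡ _     ⊤⁺≈⊤⁺   = ⊤⁺≈⊤⁺

    +⁺-identityˡ : ∀ x → (0⁺ +⁺ x) ≈⁺ x
    +⁺-identityˡ [ x ] = [ G.identityˡ x ]
    +⁺-identityˡ ⊤⁺    = ⊤⁺≈⊤⁺

    v-1 : v K.1# ≈⁺ 0⁺
    v-1 with v K.1# | v-* K.1# K.1# | v-cong (K.*-identityˡ K.1#)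
           | Equivalence.to (v-∞ K.1#)
    ... | ⊤⁺    | _  | _  | v1≈∞⇒1≈0 = contradiction (v1≈∞⇒1≈0 ⊤⁺≈⊤⁺) K.1≉0
    ... | [ g ] | eq | eq′ | _ with G⁺.Eq.trans (G⁺.Eq.sym eq) eq′
    ...   | [ g+g≈g ] =
      [ AbelianGroupProperties.identityʳ-unique G.abelianGroup g g g+g≈g ]

    v-‿1 : v (K.- K.1#) ≈⁺ 0⁺
    v-‿1 with v (K.- K.1#) | G⁺.Eq.trans (G⁺.Eq.sym (v-* (K.- K.1#) (K.- K.1#)))
                               (G⁺.Eq.trans (v-cong -1*-1≈1) v-1)
      where
      open RingProperties K.ring using (-1*x≈-x; -‿involutive)
      -1*-1≈1 = K.trans (-1*x≈-x (K.- K.1#)) (-‿involutive K.1#)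
    ... | [ g ] | [ g+g≈0 ] = [ x+x≈0⇒x≈0 g g+g≈0 ]

    v-‿ : ∀ x → v (K.- x) ≈⁺ v x
    v-‿ x = begin
      v (K.- x)             ≈⟨ v-cong (-1*x≈-x x) ⟨
      v (K.- K.1# K.* x)    ≈⟨ v-* (K.- K.1#) x ⟩
      v (K.- K.1#) +⁺ v x   ≈⟨ +⁺-congˡ (v x) v-‿1 ⟩
      0⁺ +⁺ v x             ≈⟨ +⁺-identityˡ (v x) ⟩
      v x                   ∎
      where
      open SetoidReasoning G⁺.Eq.setoid
      open RingProperties K.ring using (-1*x≈-x)

    𝔪-≈ : ∀ {x y} → x K.≈ y → 𝔪 x → 𝔪 y
    𝔪-≈ x≈y = 𝔪-resp (v-cong x≈y)

  _≡ᵣ_ : Rel (Σ K.Carrier 𝒪) (g ⊔ ℓ₁ ⊔ ℓ₂)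
  (x , _) ≡ᵣ (y , _) = 𝔪 (x K.- y)

  ≡ᵣ-isEquivalence : IsEquivalence _≡ᵣ_
  ≡ᵣ-isEquivalence = record
    { refl  = λ {(x , _)} → 𝔪-≈ (K.sym (K.-‿inverseʳ x)) 𝔪-0
    ; sym   = λ {(x , _)} {(y , _)} m →
        𝔪-≈ (⁻¹-anti-homo‿- x y) (𝔪-resp (G⁺.Eq.sym (v-‿ (x K.- y))) m)
    ; trans = λ {(x , _)} {(y , _)} {(z , _)} m m′ →
        𝔪-≈ (telescope x y z) (𝔪-+ m m′)
    }
    where
    open AbelianGroupProperties K.+-abelianGroup using (⁻¹-anti-homo‿-)
    open SetoidReasoning K.setoid
    telescope : ∀ x y z → (x K.- y) K.+ (y K.- z) K.≈ x K.- z
    telescope x y z = begin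
      (x K.- y) K.+ (y K.- z)           ≈⟨ K.+-assoc x (K.- y) (y K.- z) ⟩
      x K.+ (K.- y K.+ (y K.- z))       ≈⟨ K.+-congˡ (K.+-assoc (K.- y) y (K.- z)) ⟨
      x K.+ ((K.- y K.+ y) K.- z)       ≈⟨ K.+-congˡ (K.+-congʳ (K.-‿inverseˡ y)) ⟩
      x K.+ (K.0# K.- z)                ≈⟨ K.+-congˡ (K.+-identityˡ (K.- z)) ⟩
      x K.- z                           ∎

  residueSetoid : Setoid (c ⊔ g ⊔ ℓ₂) (g ⊔ ℓ₁ ⊔ ℓ₂)
  residueSetoid = record { isEquivalence = ≡ᵣ-isEquivalence }

HasCardinality : ∀ {a ℓ} → Setoid a ℓ → ℕ → Set (a ⊔ ℓ)
HasCardinality S n = Bijection S (setoid (Fin n))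

AtMost : ∀ {a ℓ r} (S : Setoid a ℓ) → ℕ → Pred (Setoid.Carrier S) r → Set (a ⊔ ℓ ⊔ r)
AtMost S n P = ∀ xs → Unique xs → All P xs → length xs ℕ.≤ n
  where open UniqueSetoid S using (Unique)

module _ {c ℓ} (K : Field c ℓ) where
  open Field K
  open SemiringExp semiring using (_^_)
  open SemiringSum semiring using (sum)

  -- The value at x of the polynomial Σᵢ aᵢ Xⁿⁱ; here x ^ 0 is 1#, also for x = 0.
  eval : ∀ {m} → (Fin m → Carrier) → (Fin m → ℕ) → Carrier → Carrier
  eval a n x = sum (λ i → a i * x ^ n i)

  IsZero : ∀ {m} → (Fin m → Carrier) → (Fin m → ℕ) → Pred Carrier ℓ
  IsZero a n x = eval a n x ≈ 0#

{-# OPTIONS --safe #-}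
module Submission where

-- For a nonzero zero z of f scale the terms aᵢ zⁿⁱ so that the largest has absolute
-- value 1, and substitute x = z (1 + Y). Over the prime field, Gaussian elimination on
-- the polynomials (1 + Y)ⁿⁱ yields a basis P₀, …, P_k of their span which is adapted
-- both to the degree and to the order of vanishing at Y = 0: the degrees are the nᵢ in
-- some order and the orders oⱼ increase strictly. Label z by the j for which deg Pⱼ is
-- the largest exponent whose term is maximal at z; then Pⱼ has a unit coefficient.
--
-- Along the slopes of the Newton polygon that exponent changes strictly, so zeros with
-- the same label have the same absolute value. Since |Pⱼ(Y)| = |Y|^oⱼ for |Y| < 1, a
-- second Newton polygon argument, now in Y, shows that a sequence of d further zeros
-- approaching z with strictly decreasing distances < |z| forces the label of z to be
-- at least d + 1. By counting in the tree of residue classes, each of the q − 1 classes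
-- of zeros with label j contains at most qʲ⁻¹ of them, and together with the zero at 0
-- there are at most 1 + Σ_{1 ≤ j ≤ k} (q − 1) qʲ⁻¹ = qᵏ.

open import Defs
open import Level using (Level; _⊔_)
import Algebra.Properties.AbelianGroup as AbelianGroupProperties
import Algebra.Properties.CommutativeSemiring.Exp as Exp
import Algebra.Properties.Ring as RingProperties
import Algebra.Properties.Semiring.Mult as Mult
import Algebra.Properties.Semiring.Sum as SemiringSum
open import Data.Empty using (⊥-elim)
open import Data.Fin.Base as Fin using (Fin; zero; suc; toℕ; punchIn; punchOut)
open import Data.Fin.Permutation as Permutation using (Permutation; _⟨$⟩ʳ_)
import Data.Fin.Properties as Fin
open import Data.List.Base using (List; []; _∷_; length)
open import Data.List.Membership.Propositional using (_∈_)
open import Data.List.Relation.Unary.All as All using (All; []; _∷_)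
open import Data.List.Relation.Unary.AllPairs.Core using ([]; _∷_)
open import Data.List.Relation.Unary.Any using (here; there)
import Data.List.Relation.Unary.Unique.Setoid as UniqueSetoid
open import Data.Maybe.Base using (nothing)
open import Data.Nat.Base as ℕ using (ℕ; zero; suc; z≤n; s≤s; s≤s⁻¹)
open import Data.Nat.Coprimality using (Coprime; coprime-Bézout)
open import Data.Nat.Divisibility using (_∣_; _∣?_; divides; ∣1⇒≡1; ∣m∣n⇒∣m+n; ∣n⇒∣m*n)
open import Data.Nat.GCD using (module Bézout)
open import Data.Nat.Primality using (Prime; prime⇒irreducible; ¬prime[0]; ¬prime[1])
import Data.Nat.Properties as ℕ
open import Data.Nat.Tactic.RingSolver using (solve-∀)
open import Data.Product.Base using (∃; _×_; _,_; proj₁; proj₂)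
open import Data.Sum.Base using (_⊎_; inj₁; inj₂)
open import Data.Vec.Base using (Vec; []; _∷_)
open import Data.Vec.Functional as Vector using (Vector)
open import Function.Base using (_∘_)
open import Function.Bundles using (Bijection; Equivalence)
open import Function.Definitions using (Injective)
open import Relation.Binary.Bundles using (Setoid; TotalOrder)
import Relation.Binary.Construct.Add.Supremum.NonStrict as SupremumOrder
open import Relation.Binary.Definitions using (tri<; tri≈; tri>)
open import Relation.Binary.PropositionalEquality as ≡ using (_≡_; _≢_; cong)
import Relation.Binary.Reasoning.Setoid as SetoidReasoning
open import Relation.Binary.Structures using (IsTotalOrder)
open import Relation.Nullary.Construct.Add.Supremum using (⊤⁺; [_])
open import Relation.Nullary.Decidable.Core using (Dec; yes; no)
open import Relation.Nullary.Negation.Core using (¬_; contradiction)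
open import Relation.Unary using (Pred)
open import Tactic.RingSolver.Core.AlmostCommutativeRing using (fromCommutativeRing)
import Tactic.RingSolver.NonReflective as RingSolver

-- Weighted sums and the geometric series.

sumBelow : (ℕ → ℕ) → ℕ → ℕ
sumBelow w zero    = 0
sumBelow w (suc m) = w m ℕ.+ sumBelow w m

sumBelow-const : ∀ c m → sumBelow (λ _ → c) m ≡ m ℕ.* c
sumBelow-const c zero    = ≡.refl
sumBelow-const c (suc m) = cong (c ℕ.+_) (sumBelow-const c m)

-- The bound for the zeros with a given label when the residue field has `suc q` elements: one zero
-- for label 0, and `q` residue classes of at most `suc q ^ e` zeros each for label `suc e`.
geometricWeight : ℕ → ℕ → ℕ
geometricWeight q zero    = 1
geometricWeight q (suc e) = q ℕ.* suc q ℕ.^ e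

sumBelow-geometric : ∀ q k → sumBelow (geometricWeight q) (suc k) ≡ suc q ℕ.^ k
sumBelow-geometric q zero    = ≡.refl
sumBelow-geometric q (suc k) = begin
  q ℕ.* suc q ℕ.^ k ℕ.+ sumBelow (geometricWeight q) (suc k) ≡⟨ cong (q ℕ.* suc q ℕ.^ k ℕ.+_) (sumBelow-geometric q k) ⟩
  q ℕ.* suc q ℕ.^ k ℕ.+ suc q ℕ.^ k                            ≡⟨ ℕ.+-comm (q ℕ.* suc q ℕ.^ k) _ ⟩
  suc q ℕ.^ suc k                                            ∎
  where open ≡.≡-Reasoning

-- Counting distinct points by splitting into fibres.

module _ {a ℓ} (S : Setoid a ℓ) where
  open Setoid S
  open UniqueSetoid S using (Unique)

  private
    variable
      r s t : Level
      P : Pred Carrier r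
      A : Pred Carrier s
      B : Pred Carrier t

  private
    record Split (A : Pred Carrier s) (B : Pred Carrier t) (xs : List Carrier)
                 : Set (a ⊔ ℓ ⊔ s ⊔ t) where
      field
        {ys zs}   : List Carrier
        ys-unique : Unique ys
        zs-unique : Unique zs
        ys⊆A      : All A ys
        zs⊆B      : All B zs
        lengths   : length xs ≡ length ys ℕ.+ length zs
        -- This clause lets the induction prepend a new point to `ys` or `zs` without losing
        -- uniqueness.
        inherited : ∀ {x} → All (x ≉_) xs → All (x ≉_) ys × All (x ≉_) zs

    split : (∀ {x} → P x → A x ⊎ B x) →
            ∀ {xs} → Unique xs → All P xs → Split A B xs
    split f [] [] = record
      { ys-unique = [] ; zs-unique = [] ; ys⊆A = [] ; zs⊆B = []
      ; lengths = ≡.refl ; inherited = λ _ → [] , [] }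
    split f (x∉xs ∷ u) (px ∷ pxs) with f px | split f u pxs
    ... | inj₁ ax | s = let open Split s in record
      { ys-unique = proj₁ (inherited x∉xs) ∷ ys-unique ; zs-unique = zs-unique
      ; ys⊆A = ax ∷ ys⊆A ; zs⊆B = zs⊆B ; lengths = cong suc lengths
      ; inherited = λ { (rx ∷ rxs) → rx ∷ proj₁ (inherited rxs) , proj₂ (inherited rxs) } }
    ... | inj₂ bx | s = let open Split s in record
      { ys-unique = ys-unique ; zs-unique = proj₂ (inherited x∉xs) ∷ zs-unique
      ; ys⊆A = ys⊆A ; zs⊆B = bx ∷ zs⊆B
      ; lengths = ≡.trans (cong suc lengths) (≡.sym (ℕ.+-suc (length ys) (length zs)))
      ; inherited = λ { (rx ∷ rxs) → proj₁ (inherited rxs) , rx ∷ proj₂ (inherited rxs) } }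

  atMost-⊎ : ∀ {m n} → (∀ {x} → P x → A x ⊎ B x) →
             AtMost S m A → AtMost S n B → AtMost S (m ℕ.+ n) P
  atMost-⊎ {m = m} {n} f |A|≤m |B|≤n xs u pxs = begin
    length xs                  ≡⟨ lengths ⟩
    length ys ℕ.+ length zs    ≤⟨ ℕ.+-mono-≤ (|A|≤m ys ys-unique ys⊆A) (|B|≤n zs zs-unique zs⊆B) ⟩
    m ℕ.+ n                    ∎
    where
    open Split (split f u pxs)
    open ℕ.≤-Reasoning

  atMost-empty : ∀ n → (∀ {x} → ¬ P x) → AtMost S n P
  atMost-empty n ∅ []      _ _        = z≤n
  atMost-empty n ∅ (_ ∷ _) _ (px ∷ _) = contradiction px ∅

  -- Each point is counted at the index that `cls` selects for it; the fibre over the top index is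
  -- split off first.
  atMost-fibres : (R : Carrier → ℕ → Set r) (w : ℕ → ℕ) (m : ℕ) →
                  (∀ {x} → P x → ∃ λ j → j ℕ.< m × R x j) →
                  (∀ {j} → j ℕ.< m → AtMost S (w j) (λ x → P x × R x j)) →
                  AtMost S (sumBelow w m) P
  atMost-fibres R w zero    cls _ = atMost-empty 0 λ px → ℕ.n≮0 (proj₁ (proj₂ (cls px)))
  atMost-fibres {P = P} R w (suc m) cls fib =
    atMost-⊎ {A = λ x → P x × R x m} {B = λ x → P x × ∃ λ j → j ℕ.< m × R x j} here-or-below
      (fib ℕ.≤-refl)
      (atMost-fibres R w m proj₂ λ j<m xs u a →
         fib (ℕ.<-trans j<m ℕ.≤-refl) xs u (All.map (λ ((px , _) , r) → px , r) a))
    where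
    here-or-below : ∀ {x} → P x → (P x × R x m) ⊎ (P x × ∃ λ j → j ℕ.< m × R x j)
    here-or-below px with cls px
    ... | j , j<1+m , r with ℕ.m≤n⇒m<n∨m≡n (s≤s⁻¹ j<1+m)
    ...   | inj₁ j<m    = inj₂ (px , j , j<m , r)
    ...   | inj₂ ≡.refl = inj₁ (px , r)

-- Elimination among monic polynomials over the prime field.

-- Polynomials over 𝔽_p, monic of degree n: (c₀ ∷ … ∷ cₙ₋₁ ∷ []) stands for
-- c₀ + c₁ Y + … + cₙ₋₁ Yⁿ⁻¹ + Yⁿ, with residues mod p represented by naturals.
Monic : ℕ → Set
Monic = Vec ℕ

-- Bézout inverts `e` modulo `p`, and `c` is a natural number representing `-d/e`. The two cases are
-- the two signs of the Bézout identity.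
cancelMod : ∀ {p} → Prime p → ∀ d {e} → ¬ p ∣ e → ∃ λ c → p ∣ d ℕ.+ c ℕ.* e
cancelMod {zero}  pr _ _   = contradiction pr ¬prime[0]
cancelMod {suc p} pr d {e} p∤e with coprime-Bézout {suc p} {e} coprime
  where
  coprime : Coprime (suc p) e
  coprime (i∣p , i∣e) with prime⇒irreducible pr i∣p
  ... | inj₁ i≡1    = i≡1
  ... | inj₂ ≡.refl = contradiction i∣e p∤e
... | Bézout.+- x y eq = y ℕ.* d , divides (x ℕ.* d)
      (≡.trans (≡.trans (rearrange d y e) (cong (d ℕ.*_) eq)) (assoc d x (suc p)))
  where
  rearrange : ∀ d y e → d ℕ.+ y ℕ.* d ℕ.* e ≡ d ℕ.* (1 ℕ.+ y ℕ.* e)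
  rearrange = solve-∀
  assoc : ∀ d x p → d ℕ.* (x ℕ.* p) ≡ x ℕ.* d ℕ.* p
  assoc = solve-∀
-- Here `y` inverts `e`, and the variable `p`, now one less than the prime, stands for -1.
... | Bézout.-+ x y eq = p ℕ.* d ℕ.* y , divides (d ℕ.+ p ℕ.* d ℕ.* x)
        (≡.trans (rearrange d p y e) (≡.trans (cong (λ z → d ℕ.+ p ℕ.* d ℕ.* z) (≡.sym eq)) (collect d p x)))
  where
  rearrange : ∀ d p y e → d ℕ.+ p ℕ.* d ℕ.* y ℕ.* e ≡ d ℕ.+ p ℕ.* d ℕ.* (y ℕ.* e)
  rearrange = solve-∀
  collect : ∀ d p x → d ℕ.+ p ℕ.* d ℕ.* (1 ℕ.+ x ℕ.* suc p) ≡ (d ℕ.+ p ℕ.* d ℕ.* x) ℕ.* suc p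
  collect = solve-∀

addConstant : ∀ {n} → ℕ → Monic (suc n) → Monic (suc n)
addConstant c (d ∷ P) = (c ℕ.+ d) ∷ P

-- The recursion is `(1 + Y)(c + Y P) = c + Y (c + (1 + Y) P)`.
1+Y* : ∀ {n} → Monic n → Monic (suc n)
1+Y* []      = 1 ∷ []
1+Y* (c ∷ P) = c ∷ addConstant c (1+Y* P)

[1+Y]^ : ∀ n → Monic n
[1+Y]^ zero    = []
[1+Y]^ (suc n) = 1+Y* ([1+Y]^ n)

-- Because `m < n`, the implicit leading 1 of the longer polynomial is untouched; that of the
-- shorter one enters as `c ℕ.* 1`.
addMultiple : ∀ {m n} → m ℕ.< n → ℕ → Monic m → Monic n → Monic n
addMultiple (s≤s _)   c []      (d ∷ P) = (d ℕ.+ c ℕ.* 1) ∷ P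
addMultiple (s≤s m<n) c (e ∷ Q) (d ∷ P) = (d ℕ.+ c ℕ.* e) ∷ addMultiple m<n c Q P

module _ {p} (p-prime : Prime p) where

  -- Order of vanishing at Y = 0.
  data Order : ∀ {n} → Monic n → ℕ → Set where
    one  : Order [] 0
    unit : ∀ {n c} {P : Monic n} → ¬ p ∣ c → Order (c ∷ P) 0
    root : ∀ {n c o} {P : Monic n} → p ∣ c → Order P o → Order (c ∷ P) (suc o)

  p∤1 : ¬ p ∣ 1
  p∤1 p∣1 with ≡.refl ← ∣1⇒≡1 p∣1 = ¬prime[1] p-prime

  order : ∀ {n} (P : Monic n) → ∃ (Order P)
  order []      = 0 , one
  order (c ∷ P) with p ∣? c | order P
  ... | no  p∤c | _      = 0 , unit p∤c
  ... | yes p∣c | o , op = suc o , root p∣c op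

  order-[1+Y]^ : ∀ n → Order ([1+Y]^ n) 0
  order-[1+Y]^ zero          = one
  order-[1+Y]^ (suc zero)    = unit p∤1
  order-[1+Y]^ (suc (suc n)) = order-1+Y* (order-[1+Y]^ (suc n))
    where
    order-1+Y* : ∀ {n} {P : Monic (suc n)} → Order P 0 → Order (1+Y* P) 0
    order-1+Y* {P = c ∷ P} (unit p∤c) = unit p∤c

  -- Once the common power of `Y` is stripped, both constant coefficients are prime to `p`, so
  -- `cancelMod` finds a multiple of `Q` that removes the one of `P`.
  raiseOrder : ∀ {m n o} {P : Monic n} {Q : Monic m} (m<n : m ℕ.< n) → Order P o → Order Q o →
               ∃ λ c → ∃ λ o′ → o ℕ.< o′ × Order (addMultiple m<n c Q P) o′
  raiseOrder {P = d ∷ P} (s≤s _) (unit _) one =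
    let c , p∣ = cancelMod p-prime d p∤1 ; o′ , op = order P in c , suc o′ , s≤s z≤n , root p∣ op
  raiseOrder {P = d ∷ P} {e ∷ Q} (s≤s m<n) (unit _) (unit p∤e) =
    let c , p∣ = cancelMod p-prime d p∤e ; o′ , op = order (addMultiple m<n c Q P)
    in c , suc o′ , s≤s z≤n , root p∣ op
  raiseOrder (s≤s m<n) (root p∣d oP) (root p∣e oQ) =
    let c , o′ , o<o′ , op = raiseOrder m<n oP oQ
    in c , suc o′ , s≤s o<o′ , root (∣m∣n⇒∣m+n p∣d (∣n⇒∣m*n c p∣e)) op

-- The absolute value and its ordering.

module AbsoluteValue {c ℓ g ℓ₁ ℓ₂} {K : Field c ℓ} {G : OrderedAbelianGroup g ℓ₁ ℓ₂}
                     (V : Valuation K G) where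
  open Field K hiding (zero)
  open Valuation V
  private
    module G  = OrderedAbelianGroup G
    module ≤  = IsTotalOrder G.isTotalOrder
    module G⁺ = TotalOrder G.totalOrder⁺
  open G using (_≈⁺_; _≤⁺_; _+⁺_; 0⁺; [_]; ⊤⁺≈⊤⁺)

  infix 4 _⊑_ _≾_ _≺_

  -- Reading v multiplicatively: x ⊑ y means |x| ≤ |y|. Equality in G is not
  -- decidable, so the working relations ≾ and ≺ are made stable under ¬¬; finiteness
  -- of the residue field then makes them decidable.
  _⊑_ _≾_ _≺_ : Carrier → Carrier → Set (g ⊔ ℓ₂)
  x ⊑ y = v y ≤⁺ v x
  x ≾ y = ¬ ¬ (x ⊑ y)
  x ≺ y = x ≾ y × ¬ (y ≾ x)

  ⊑⇒≾ : ∀ {x y} → x ⊑ y → x ≾ y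
  ⊑⇒≾ p ¬p = ¬p p

  ⊑-reflexive : ∀ {x y} → x ≈ y → x ⊑ y
  ⊑-reflexive x≈y = G⁺.reflexive (v-cong (sym x≈y))

  ⊑-trans : ∀ {x y z} → x ⊑ y → y ⊑ z → x ⊑ z
  ⊑-trans p q = G⁺.trans q p

  ⊑-total : ∀ x y → x ⊑ y ⊎ y ⊑ x
  ⊑-total x y = G⁺.total (v y) (v x)

  ≈0⇒⊑ : ∀ {x} y → x ≈ 0# → x ⊑ y
  ≈0⇒⊑ {x} y x≈0 with v x | Equivalence.from (v-∞ x) x≈0
  ... | ⊤⁺ | _ = v y SupremumOrder.≤⊤⁺

  ⊑0⇒≈0 : ∀ {x} → x ⊑ 0# → x ≈ 0#
  ⊑0⇒≈0 {x} x⊑0 = Equivalence.to (v-∞ x) (G⁺.antisym (v x SupremumOrder.≤⊤⁺)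
    (G⁺.trans (G⁺.reflexive (G⁺.Eq.sym (Equivalence.from (v-∞ 0#) refl))) x⊑0))

  _≈0? : ∀ x → Dec (x ≈ 0#)
  x ≈0? with v x | Equivalence.to (v-∞ x) | Equivalence.from (v-∞ x)
  ... | ⊤⁺    | f | _ = yes (f ⊤⁺≈⊤⁺)
  ... | [ _ ] | _ | f = no λ x≈0 → contradiction (f x≈0) λ ()

  private
    +⁺-mono : ∀ {w x y z} → w ≤⁺ x → y ≤⁺ z → (w +⁺ y) ≤⁺ (x +⁺ z)
    +⁺-mono {z = ⊤⁺}    SupremumOrder.[ _ ] _ = _ SupremumOrder.≤⊤⁺
    +⁺-mono {[ w ]} {[ x ]} {[ y ]} {[ z ]} SupremumOrder.[ w≤x ] SupremumOrder.[ y≤z ] =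
      SupremumOrder.[ ≤.trans (G.+-monoʳ-≤ w y≤z) (≤.trans (≤.reflexive (G.comm w z))
        (≤.trans (G.+-monoʳ-≤ z w≤x) (≤.reflexive (G.comm z x)))) ]
    +⁺-mono (_ SupremumOrder.≤⊤⁺) _ = _ SupremumOrder.≤⊤⁺

  ⊑-* : ∀ {w x y z} → w ⊑ x → y ⊑ z → w * y ⊑ x * z
  ⊑-* {w} {x} {y} {z} w⊑x y⊑z = G⁺.trans (G⁺.reflexive (v-* x z))
    (G⁺.trans (+⁺-mono w⊑x y⊑z) (G⁺.reflexive (G⁺.Eq.sym (v-* w y))))

  ⊑-+ : ∀ {x y z} → x ⊑ z → y ⊑ z → x + y ⊑ z
  ⊑-+ {x} {y} x⊑z y⊑z with G⁺.total (v x) (v y) | v-+ x y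
  ... | inj₁ _ | vx≤ = G⁺.trans x⊑z vx≤
  ... | inj₂ _ | vy≤ = G⁺.trans y⊑z vy≤

  v-1 : v 1# ≈⁺ 0⁺
  v-1 with v 1# | v-* 1# 1# | v-cong (*-identityˡ 1#) | Equivalence.to (v-∞ 1#)
  ... | ⊤⁺    | _  | _   | to = contradiction (to ⊤⁺≈⊤⁺) 1≉0
  ... | [ γ ] | eq | eq′ | _ with G⁺.Eq.trans (G⁺.Eq.sym eq) eq′
  ...   | [ γ+γ≈γ ] = [ AbelianGroupProperties.identityʳ-unique G.abelianGroup γ γ γ+γ≈γ ]

  ⊑1⇒𝒪 : ∀ {x} → x ⊑ 1# → 𝒪 V x
  ⊑1⇒𝒪 = G⁺.trans (G⁺.reflexive (G⁺.Eq.sym v-1))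

  𝔪⇒≺1 : ∀ {x} → 𝔪 V x → x ≺ 1#
  𝔪⇒≺1 (0≤vx , 0≉vx) =
      ⊑⇒≾ (G⁺.trans (G⁺.reflexive v-1) 0≤vx)
    , λ 1≾x → 1≾x λ vx≤v1 → 0≉vx (G⁺.antisym 0≤vx (G⁺.trans vx≤v1 (G⁺.reflexive v-1)))

  -- Not lying in `𝔪` says only that `v x` cannot differ from 0, which is why the conclusion uses
  -- the stable relation.
  ≾1∧¬𝔪⇒1≾ : ∀ {x} → x ⊑ 1# → ¬ 𝔪 V x → 1# ≾ x
  ≾1∧¬𝔪⇒1≾ x⊑1 x∉𝔪 ¬1⊑x = x∉𝔪 (⊑1⇒𝒪 x⊑1 , λ 0≈vx →
    ¬1⊑x (G⁺.reflexive (G⁺.Eq.trans (G⁺.Eq.sym 0≈vx) (G⁺.Eq.sym v-1))))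

  ≾-reflexive : ∀ {x y} → x ≈ y → x ≾ y
  ≾-reflexive = ⊑⇒≾ ∘ ⊑-reflexive

  ≾-refl : ∀ {x} → x ≾ x
  ≾-refl = ≾-reflexive refl

  ≾-trans : ∀ {x y z} → x ≾ y → y ≾ z → x ≾ z
  ≾-trans p q ¬r = p λ p′ → q λ q′ → ¬r (⊑-trans p′ q′)

  ≾-* : ∀ {w x y z} → w ≾ x → y ≾ z → w * y ≾ x * z
  ≾-* p q ¬r = p λ p′ → q λ q′ → ¬r (⊑-* p′ q′)

  ≾-+ : ∀ {x y z} → x ≾ z → y ≾ z → x + y ≾ z
  ≾-+ p q ¬r = p λ p′ → q λ q′ → ¬r (⊑-+ p′ q′)

  ≈0⇒≾ : ∀ {x} y → x ≈ 0# → x ≾ y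
  ≈0⇒≾ y = ⊑⇒≾ ∘ ≈0⇒⊑ y

  ≾0⇒≈0 : ∀ {x} → x ≾ 0# → x ≈ 0#
  ≾0⇒≈0 {x} p with x ≈0?
  ... | yes x≈0 = x≈0
  ... | no  x≉0 = ⊥-elim (p (x≉0 ∘ ⊑0⇒≈0))

  ≺⇒≾ : ∀ {x y} → x ≺ y → x ≾ y
  ≺⇒≾ = proj₁

  ≺-irrefl : ∀ {x} → ¬ x ≺ x
  ≺-irrefl (p , ¬p) = ¬p p

  ≺-≾-trans : ∀ {x y z} → x ≺ y → y ≾ z → x ≺ z
  ≺-≾-trans (p , ¬p) q = ≾-trans p q , λ r → ¬p (≾-trans q r)

  ≾-≺-trans : ∀ {x y z} → x ≾ y → y ≺ z → x ≺ z
  ≾-≺-trans q (p , ¬p) = ≾-trans q p , λ r → ¬p (≾-trans r q)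

  ≺⇒≉0 : ∀ {x y} → x ≺ y → y ≉ 0#
  ≺⇒≉0 (_ , ¬p) y≈0 = ¬p (≈0⇒≾ _ y≈0)

  0≺ : ∀ {x} → x ≉ 0# → 0# ≺ x
  0≺ x≉0 = ≈0⇒≾ _ refl , x≉0 ∘ ≾0⇒≈0

  ≿⇒≉0 : ∀ {x y} → x ≉ 0# → x ≾ y → y ≉ 0#
  ≿⇒≉0 x≉0 x≾y y≈0 = x≉0 (≾0⇒≈0 (≾-trans x≾y (≾-reflexive y≈0)))

  inv : ∀ {x} → x ≉ 0# → Carrier
  inv {x} x≉0 = proj₁ (invertible x x≉0)

  inv-* : ∀ {x} (x≉0 : x ≉ 0#) → x * inv x≉0 ≈ 1#
  inv-* {x} x≉0 = proj₂ (invertible x x≉0)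

  *-inv-cancel : ∀ {x} (x≉0 : x ≉ 0#) y → y * x * inv x≉0 ≈ y
  *-inv-cancel x≉0 y = trans (*-assoc y _ _) (trans (*-congˡ (inv-* x≉0)) (*-identityʳ y))

  inv-*-cancel : ∀ {x} (x≉0 : x ≉ 0#) y → y * inv x≉0 * x ≈ y
  inv-*-cancel x≉0 y = trans (*-assoc y _ _)
    (trans (*-congˡ (trans (*-comm _ _) (inv-* x≉0))) (*-identityʳ y))

  *-≉0 : ∀ {x y} → x ≉ 0# → y ≉ 0# → x * y ≉ 0#
  *-≉0 {x} x≉0 y≉0 xy≈0 = x≉0 (trans (sym (*-inv-cancel y≉0 x)) (trans (*-congʳ xy≈0) (zeroˡ _)))

  inv≉0 : ∀ {x} (x≉0 : x ≉ 0#) → inv x≉0 ≉ 0#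
  inv≉0 x≉0 i≈0 = 1≉0 (trans (sym (inv-* x≉0)) (trans (*-congˡ i≈0) (zeroʳ _)))

  ≾-*-cancelʳ : ∀ {x y z} → z ≉ 0# → x * z ≾ y * z → x ≾ y
  ≾-*-cancelʳ {x} {y} z≉0 p = ≾-trans (≾-reflexive (sym (*-inv-cancel z≉0 x)))
    (≾-trans (≾-* p (≾-refl {inv z≉0})) (≾-reflexive (*-inv-cancel z≉0 y)))

  ≺-*ʳ : ∀ {x y z} → z ≉ 0# → x ≺ y → x * z ≺ y * z
  ≺-*ʳ z≉0 (p , ¬p) = ≾-* p ≾-refl , ¬p ∘ ≾-*-cancelʳ z≉0

  ≺-*-≾ : ∀ {w x y z} → w ≺ x → y ≾ z → z ≉ 0# → w * y ≺ x * z
  ≺-*-≾ w≺x y≾z z≉0 = ≾-≺-trans (≾-* ≾-refl y≾z) (≺-*ʳ z≉0 w≺x)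

  ≾-*-≺ : ∀ {w x y z} → w ≾ x → x ≉ 0# → y ≺ z → w * y ≺ x * z
  ≾-*-≺ w≾x x≉0 y≺z = ≾-≺-trans (≾-reflexive (*-comm _ _))
    (≺-≾-trans (≺-*-≾ y≺z w≾x x≉0) (≾-reflexive (*-comm _ _)))

  -- Residues and the decidable comparison of absolute values.

  module _ {q} (card : HasCardinality (residueSetoid V) q) where
    open Bijection card using (to; injective) renaming (cong to to-cong)

    -- The class of `x / b` in the residue field; it tells apart the open discs of radius |b| inside
    -- the closed one around 0.
    residue : ∀ {b} → b ≉ 0# → ∀ {x} → x ⊑ b → Fin q
    residue b≉0 {x} x⊑b = to (x * inv b≉0 ,
      ⊑1⇒𝒪 (⊑-trans (⊑-* x⊑b (⊑-reflexive refl)) (⊑-reflexive (inv-* b≉0))))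

    residue-≡ : ∀ {b} (b≉0 : b ≉ 0#) {x y} (x⊑b : x ⊑ b) (y⊑b : y ⊑ b) →
                residue b≉0 x⊑b ≡ residue b≉0 y⊑b → x - y ≺ b
    residue-≡ {b} b≉0 {x} {y} _ _ eq = ≾-≺-trans (≾-reflexive (sym eq′))
      (≺-≾-trans (≺-*ʳ b≉0 (𝔪⇒≺1 (injective eq))) (≾-reflexive (*-identityˡ b)))
      where
      open RingProperties ring using (-‿distribˡ-*)
      eq′ : (x * inv b≉0 - y * inv b≉0) * b ≈ x - y
      eq′ = begin
        (x * inv b≉0 - y * inv b≉0) * b       ≈⟨ distribʳ b _ _ ⟩
        x * inv b≉0 * b + - (y * inv b≉0) * b ≈⟨ +-cong (inv-*-cancel b≉0 x) (sym (-‿distribˡ-* _ b)) ⟩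
        x - y * inv b≉0 * b                   ≈⟨ +-congˡ (-‿cong (inv-*-cancel b≉0 y)) ⟩
        x - y                                 ∎
        where open SetoidReasoning setoid

    -- Totality leaves open only the case `y ⊑ x` with `x` nonzero. There |y| < |x| exactly when
    -- `y / x` has residue 0, and equality of residues is decidable in `Fin q`.
    compare : ∀ x y → x ≾ y ⊎ y ≺ x
    compare x y with ⊑-total x y | x ≈0?
    ... | inj₁ x⊑y | _       = inj₁ (⊑⇒≾ x⊑y)
    ... | inj₂ _   | yes x≈0 = inj₁ (≈0⇒≾ y x≈0)
    ... | inj₂ y⊑x | no x≉0 with residue x≉0 y⊑x Fin.≟ residue x≉0 (≈0⇒⊑ x refl)
    ...   | yes eq = inj₂ (≾-≺-trans (≾-reflexive (sym y-0≈y)) (residue-≡ x≉0 _ (≈0⇒⊑ x refl) eq))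
      where
      open RingProperties ring using (-0#≈0#)
      y-0≈y : y - 0# ≈ y
      y-0≈y = trans (+-congˡ -0#≈0#) (+-identityʳ y)
    ...   | no neq = inj₁ (≾-trans (≾-reflexive (sym (*-identityˡ x)))
                       (≾-trans (≾-* 1≾y/x ≾-refl) (≾-reflexive (inv-*-cancel x≉0 y))))
      where
      open RingProperties ring using (-0#≈0#)
      y/x⊑1 : y * inv x≉0 ⊑ 1#
      y/x⊑1 = ⊑-trans (⊑-* y⊑x (⊑-reflexive refl)) (⊑-reflexive (inv-* x≉0))
      y/x-0 : y * inv x≉0 - 0# * inv x≉0 ≈ y * inv x≉0
      y/x-0 = trans (+-congˡ (trans (-‿cong (zeroˡ _)) -0#≈0#)) (+-identityʳ _)
      1≾y/x : 1# ≾ y * inv x≉0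
      1≾y/x = ≾1∧¬𝔪⇒1≾ y/x⊑1 λ (0≤v , 0≉v) → neq (to-cong
        ( G⁺.trans 0≤v (G⁺.reflexive (v-cong (sym y/x-0)))
        , λ 0≈v → 0≉v (G⁺.Eq.trans 0≈v (v-cong y/x-0))))

  -- Negatives, powers and finite maxima.

  open Exp commutativeSemiring using (_^_; ^-congˡ; ^-homo-*; ^-distrib-*)
  open SemiringSum semiring using (sum; sum-remove; sum-cong-≋; *-distribˡ-sum)
  open RingProperties ring using (-1*x≈-x; -‿involutive; -0#≈0#; +-inverseˡ-unique; x∙y⁻¹≈ε⇒x≈y)
  open RingSolver (fromCommutativeRing commutativeRing (λ _ → nothing)) using (solve; _⊜_; _⊕_; _⊗_; ⊝_)

  -‿translate : ∀ x y z → x - y ≈ (x - z) - (y - z)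
  -‿translate x y z = sym (begin
    (x - z) - (y - z)     ≈⟨ +-congˡ (AbelianGroupProperties.⁻¹-anti-homo‿- +-abelianGroup y z) ⟩
    (x - z) + (z - y)     ≈⟨ +-assoc x (- z) (z - y) ⟩
    x + (- z + (z - y))   ≈⟨ +-congˡ (+-assoc (- z) z (- y)) ⟨
    x + ((- z + z) - y)   ≈⟨ +-congˡ (+-congʳ (-‿inverseˡ z)) ⟩
    x + (0# - y)          ≈⟨ +-congˡ (+-identityˡ (- y)) ⟩
    x - y                 ∎)
    where open SetoidReasoning setoid

  -- If 1 ⊑ −1, then multiplication by −1 gives −1 ⊑ (−1)² = 1.
  -1⊑1 : - 1# ⊑ 1#
  -1⊑1 with ⊑-total (- 1#) 1#
  ... | inj₁ p = p
  ... | inj₂ p = ⊑-trans (⊑-reflexive (sym (*-identityˡ (- 1#))))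
    (⊑-trans (⊑-* p (⊑-reflexive refl)) (⊑-reflexive (trans (-1*x≈-x (- 1#)) (-‿involutive 1#))))

  -‿⊑ : ∀ x → - x ⊑ x
  -‿⊑ x = ⊑-trans (⊑-reflexive (sym (-1*x≈-x x)))
    (⊑-trans (⊑-* -1⊑1 (⊑-reflexive refl)) (⊑-reflexive (*-identityˡ x)))

  ≾-neg : ∀ {x y} → x ≾ y → - x ≾ y
  ≾-neg = ≾-trans (⊑⇒≾ (-‿⊑ _))

  ≉⇒-≉0 : ∀ {x y} → x ≉ y → x - y ≉ 0#
  ≉⇒-≉0 x≉y = x≉y ∘ x∙y⁻¹≈ε⇒x≈y _ _

  ^-≉0 : ∀ {x} n → x ≉ 0# → x ^ n ≉ 0#
  ^-≉0 zero    _   = 1≉0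
  ^-≉0 (suc n) x≉0 = *-≉0 x≉0 (^-≉0 n x≉0)

  1^-≾ : ∀ n x → x * 1# ^ n ≾ x
  1^-≾ n x = ≾-trans (≾-* ≾-refl (1^n≾1 n)) (≾-reflexive (*-identityʳ x))
    where
    1^n≾1 : ∀ n → 1# ^ n ≾ 1#
    1^n≾1 zero    = ≾-refl
    1^n≾1 (suc n) = ≾-trans (≾-reflexive (*-identityˡ _)) (1^n≾1 n)

  1≾1^ : ∀ n x → x ≾ x * 1# ^ n
  1≾1^ zero    x = ≾-reflexive (sym (*-identityʳ x))
  1≾1^ (suc n) x = ≾-trans (1≾1^ n x) (≾-* ≾-refl (≾-reflexive (sym (*-identityˡ _))))

  ^-≺1 : ∀ {x} n → x ≺ 1# → x ^ suc n ≺ 1#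
  ^-≺1 {x} n x≺1 = ≺-≾-trans (≺-*-≾ x≺1 (x^n≾1 n) 1≉0) (≾-reflexive (*-identityˡ 1#))
    where
    x^n≾1 : ∀ n → x ^ n ≾ 1#
    x^n≾1 zero    = ≾-refl
    x^n≾1 (suc n) = ≺⇒≾ (^-≺1 n x≺1)

  -- On a smaller disc a higher power loses against a lower one.
  shrink : ∀ {a b x y m n} → y ≉ 0# → y ≺ x → m ℕ.< n → b ≉ 0# →
           a * x ^ n ≾ b * x ^ m → a * y ^ n ≺ b * y ^ m
  shrink {a} {b} {x} {y} {m} {n} y≉0 y≺x m<n b≉0 p =
    ≾-≺-trans (≾-reflexive (rescale a n))
      (≺-≾-trans (≾-*-≺ p (*-≉0 b≉0 (^-≉0 m x≉0)) w^n≺w^m) (≾-reflexive (sym (rescale b m))))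
    where
    x≉0 = ≺⇒≉0 y≺x
    w = y * inv x≉0
    w≉0 = *-≉0 y≉0 (inv≉0 x≉0)

    w≺1 : w ≺ 1#
    w≺1 = ≺-≾-trans (≺-*ʳ (inv≉0 x≉0) y≺x) (≾-reflexive (inv-* x≉0))

    rescale : ∀ e k → e * y ^ k ≈ e * x ^ k * w ^ k
    rescale e k = trans (*-congˡ (trans (^-congˡ k (trans (sym (inv-*-cancel x≉0 y)) (*-comm w x)))
      (^-distrib-* x w k))) (sym (*-assoc e _ _))

    w^n≺w^m : w ^ n ≺ w ^ m
    w^n≺w^m with k , ≡.refl ← ℕ.m≤n⇒∃[o]m+o≡n m<n =
      ≾-≺-trans (≾-reflexive (trans (reflexive (cong (w ^_) (≡.sym (ℕ.+-suc m k)))) (^-homo-* w m (suc k))))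
        (≺-≾-trans (≾-*-≺ (≾-refl {w ^ m}) (^-≉0 m w≉0) (^-≺1 k w≺1)) (≾-reflexive (*-identityʳ _)))

  sum-≾ : ∀ {m x} (t : Fin m → Carrier) → (∀ i → t i ≾ x) → sum t ≾ x
  sum-≾ {zero}  t _ = ≈0⇒≾ _ refl
  sum-≾ {suc m} t p = ≾-+ (p zero) (sum-≾ (t ∘ suc) (p ∘ suc))

  -- Stated with `⊑` and not with its stable form, because `residue` takes a `⊑` bound by the
  -- maximum.
  ⊑-max : (f : Carrier → Carrier) → ∀ x xs → ∃ λ m → m ∈ (x ∷ xs) × All (λ z → f z ⊑ f m) (x ∷ xs)
  ⊑-max f x [] = x , here ≡.refl , ⊑-reflexive refl ∷ []
  ⊑-max f x (y ∷ ys) with ⊑-max f y ys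
  ... | m , m∈ , p with ⊑-total (f x) (f m)
  ...   | inj₁ x⊑m = m , there m∈ , x⊑m ∷ p
  ...   | inj₂ m⊑x = x , here ≡.refl , ⊑-reflexive refl ∷ All.map (λ q → ⊑-trans q m⊑x) p

  -- The listed points of S approach x, at strictly decreasing distances below |b|.
  data Comb {s} (S : Pred Carrier s) (x : Carrier) : Carrier → List Carrier → Set (c ⊔ ℓ ⊔ g ⊔ ℓ₂ ⊔ s) where
    []    : ∀ {b} → Comb S x b []
    tooth : ∀ {b y ys} → S y → y - x ≉ 0# → y - x ≺ b → Comb S x (y - x) ys → Comb S x b (y ∷ ys)

  comb-≾ : ∀ {s} {S : Pred Carrier s} {x b b′ ys} → b ≾ b′ → Comb S x b ys → Comb S x b′ ys
  comb-≾ p [] = []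
  comb-≾ p (tooth sy y≉x y≺b cs) = tooth sy y≉x (≺-≾-trans y≺b p) cs

  -- Ultrametric estimates with decidable comparison.

  module DecidableValue {q′} (card : HasCardinality (residueSetoid V) (suc q′)) where

    private
      q = suc q′

    _≾?_ : ∀ x y → Dec (x ≾ y)
    x ≾? y with compare card x y
    ... | inj₁ x≾y = yes x≾y
    ... | inj₂ y≺x = no (proj₂ y≺x)

    ≺-+ : ∀ {x y z} → x ≺ z → y ≺ z → x + y ≺ z
    ≺-+ {x} {y} x≺z y≺z with compare card x y
    ... | inj₁ x≾y = ≾-≺-trans (≾-+ x≾y ≾-refl) y≺z
    ... | inj₂ y≺x = ≾-≺-trans (≾-+ ≾-refl (≺⇒≾ y≺x)) x≺z

    sum-≺ : ∀ {m x} (t : Fin m → Carrier) → x ≉ 0# → (∀ i → t i ≺ x) → sum t ≺ x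
    sum-≺ {zero}  t x≉0 _ = 0≺ x≉0
    sum-≺ {suc m} t x≉0 p = ≺-+ (p zero) (sum-≺ (t ∘ suc) x≉0 (p ∘ suc))

    -- Ties go to the smallest index: when the exponents decrease, this picks the largest exponent
    -- with a maximal term.
    firstMax : ∀ {m} (t : Fin (suc m) → Carrier) →
               ∃ λ i → (∀ h → t h ≾ t i) × (∀ h → h Fin.< i → t h ≺ t i)
    firstMax {zero}  t = zero , (λ { zero → ≾-refl }) , λ _ ()
    firstMax {suc m} t with firstMax (t ∘ suc)
    ... | i , max , first with compare card (t (suc i)) (t zero)
    ...   | inj₁ p = zero , (λ { zero → ≾-refl ; (suc h) → ≾-trans (max h) p }) , λ _ ()
    ...   | inj₂ p = suc i , (λ { zero → ≺⇒≾ p ; (suc h) → max h })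
                           , (λ { zero _ → p ; (suc h) (s≤s h<i) → first h h<i })

    -- A vanishing sum attains its maximal absolute value at least twice.
    second-max : ∀ {m} (t : Fin m → Carrier) → sum t ≈ 0# → ∀ i → t i ≉ 0# →
                 ∃ λ h → h ≢ i × t i ≾ t h
    second-max {suc m} t sum≈0 i ti≉0 with Fin.any? (λ h → t i ≾? t (punchIn i h))
    ... | yes (h , p) = punchIn i h , Fin.punchInᵢ≢i i h , p
    ... | no  none    = ⊥-elim (≺-irrefl (≾-≺-trans
            (≾-trans (≾-reflexive (+-inverseˡ-unique _ _ (trans (sym (sum-remove t)) sum≈0)))
              (≾-neg ≾-refl))
            (sum-≺ (t ∘ punchIn i) ti≉0 smaller)))
      where
      smaller : ∀ h → t (punchIn i h) ≺ t i
      smaller h with compare card (t i) (t (punchIn i h))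
      ... | inj₁ p = ⊥-elim (none (h , p))
      ... | inj₂ p = p

    -- Counting in the tree of residue classes.

    ResidueClass : ∀ {b} → b ≉ 0# → Carrier → Carrier → ℕ → Set (g ⊔ ℓ₂)
    ResidueClass {b} b≉0 u z j = ∃ λ (z-u⊑b : z - u ⊑ b) → toℕ (residue card b≉0 z-u⊑b) ≡ j

    residueClass-≺ : ∀ {b} (b≉0 : b ≉ 0#) {u y z j} →
                     ResidueClass b≉0 u y j → ResidueClass b≉0 u z j → y - z ≺ b
    residueClass-≺ b≉0 {u} {y} {z} (p , eq) (p′ , eq′) =
      ≾-≺-trans (≾-reflexive (-‿translate y z u))
        (residue-≡ card b≉0 p p′ (Fin.toℕ-injective (≡.trans eq (≡.sym eq′))))

    -- Every branching of the tree of residue classes in which a point of P lies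
    -- contributes a tooth to a comb at that point.
    combs-bounded : ∀ {s r} {S : Pred Carrier s} e b (P : Pred Carrier r) →
                    (∀ {x} → P x → S x) →
                    (∀ {x y} → P x → P y → x - y ≺ b) →
                    (∀ {x ys} → P x → Comb S x b ys → length ys ℕ.≤ e) →
                    AtMost setoid (q ℕ.^ e) P
    combs-bounded e b P P⊆S P≺b short [] _ _ = z≤n
    combs-bounded {S = S} e b P P⊆S P≺b short (u ∷ []) _ _ = ℕ.m^n>0 q e
    combs-bounded {S = S} e b P P⊆S P≺b short xs@(u ∷ w ∷ ws) (u∉ ∷ uniq) pxs@(pu ∷ pws)
      with m , m∈ , max ← ⊑-max (_- u) w ws | e
    -- Two distinct points already give a comb with one tooth.
    ... | zero   = ⊥-elim (ℕ.n≮0 (short pu (tooth (P⊆S pm) δ≉0 (P≺b pm pu) [])))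
      where
      pm  = All.lookup pws m∈
      δ≉0 = ≉⇒-≉0 (All.lookup u∉ m∈ ∘ sym)
    ... | suc e′ = ≡.subst (length xs ℕ.≤_) (sumBelow-const (q ℕ.^ e′) q)
        -- All points lie in the closed disc of radius |δ| around `u`. It splits into `q` classes,
        -- inside which distances are below |δ| and combs are one tooth shorter.
        (atMost-fibres setoid {P = P′} (ResidueClass δ≉0 u) (λ _ → q ℕ.^ e′) q
          (λ (px , x-u⊑δ) → _ , Fin.toℕ<n _ , x-u⊑δ , ≡.refl)
          (λ {j} _ → combs-bounded e′ δ (λ x → P′ x × ResidueClass δ≉0 u x j)
            (P⊆S ∘ proj₁ ∘ proj₁)
            (λ (_ , cx) (_ , cy) → residueClass-≺ δ≉0 cx cy)
            (λ ((px , _) , _) cs → s≤s⁻¹ (short px (proj₂ (extend px cs)))))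
          xs (u∉ ∷ uniq) (All.zip (pxs , (≈0⇒⊑ _ (-‿inverseʳ u) ∷ max))))
      where
      δ = m - u
      pm = All.lookup pws m∈
      δ≉0 : δ ≉ 0#
      δ≉0 = ≉⇒-≉0 (All.lookup u∉ m∈ ∘ sym)

      P′ : Pred Carrier _
      P′ x = P x × x - u ⊑ δ

      -- The points `u` and `m` are |δ| apart, so by the ultrametric inequality they cannot both be
      -- closer than |δ| to `x`; one that is not becomes the first tooth.
      extend : ∀ {x ys} → P x → Comb S x δ ys → ∃ λ y → Comb S x b (y ∷ ys)
      extend {x} px cs with compare card δ (u - x)
      ... | inj₁ δ≾ = u , tooth (P⊆S pu) (≿⇒≉0 δ≉0 δ≾) (P≺b pu px) (comb-≾ δ≾ cs)
      ... | inj₂ u-x≺δ with compare card δ (m - x)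
      ...   | inj₁ δ≾ = m , tooth (P⊆S pm) (≿⇒≉0 δ≉0 δ≾) (P≺b pm px) (comb-≾ δ≾ cs)
      ...   | inj₂ m-x≺δ = ⊥-elim (≺-irrefl (≾-≺-trans (≾-reflexive (-‿translate m u x))
              (≺-+ m-x≺δ (≾-≺-trans (≾-neg ≾-refl) u-x≺δ))))

    1≾∧≺1⇒1≾- : ∀ {x y} → 1# ≾ x → y ≺ 1# → 1# ≾ x - y
    1≾∧≺1⇒1≾- {x} {y} 1≾x y≺1 with compare card 1# (x - y)
    ... | inj₁ p = p
    ... | inj₂ x-y≺1 = ⊥-elim (≺-irrefl (≾-≺-trans (≾-trans 1≾x (≾-reflexive (sym x-y+y≈x))) (≺-+ x-y≺1 y≺1)))
      where
      x-y+y≈x : x - y + y ≈ x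
      x-y+y≈x = trans (+-assoc x _ _) (trans (+-congˡ (-‿inverseˡ y)) (+-identityʳ x))

    -- Values of polynomials over the prime field on the open unit disc.

    module Characteristic {p} (p-prime : Prime p) (char : HasCharacteristic K p) where
      open Mult semiring using (×-homo-+; ×1-homo-*) renaming (_×_ to _·_)

      ι : ℕ → Carrier
      ι n = n · 1#

      ι≾1 : ∀ n → ι n ≾ 1#
      ι≾1 zero    = ≈0⇒≾ 1# refl
      ι≾1 (suc n) = ≾-+ ≾-refl (ι≾1 n)

      -- Some natural `c` satisfies `p ∣ 1 + c n`; then `1 = -(c n)` in the field, and |c| ≤ 1.
      1≾ι : ∀ {n} → ¬ p ∣ n → 1# ≾ ι n
      1≾ι {n} p∤n with c , p∣1+cn ← cancelMod p-prime 1 p∤n =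
        ≾-trans (≾-reflexive (+-inverseˡ-unique 1# _
            (trans (+-congˡ (sym (×1-homo-* c n))) (Equivalence.from (char _) p∣1+cn))))
          (≾-neg (≾-trans (≾-* (ι≾1 c) ≾-refl) (≾-reflexive (*-identityˡ _))))

      ⟦_⟧ : ∀ {n} → Monic n → Carrier → Carrier
      ⟦ [] ⟧    Y = 1#
      ⟦ c ∷ P ⟧ Y = ι c + Y * ⟦ P ⟧ Y

      ⟦⟧-≾1 : ∀ {n} (P : Monic n) {Y} → Y ≺ 1# → ⟦ P ⟧ Y ≾ 1#
      ⟦⟧-≾1 []      Y≺1 = ≾-refl
      ⟦⟧-≾1 (c ∷ P) Y≺1 = ≾-+ (ι≾1 c)
        (≾-trans (≾-* (≺⇒≾ Y≺1) (⟦⟧-≾1 P Y≺1)) (≾-reflexive (*-identityˡ 1#)))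

      ⟦addConstant⟧ : ∀ {n} c (P : Monic (suc n)) Y → ⟦ addConstant c P ⟧ Y ≈ ι c + ⟦ P ⟧ Y
      ⟦addConstant⟧ c (d ∷ P) Y = trans (+-congʳ (×-homo-+ 1# c d)) (+-assoc _ _ _)

      ⟦1+Y*⟧ : ∀ {n} (P : Monic n) Y → ⟦ 1+Y* P ⟧ Y ≈ (1# + Y) * ⟦ P ⟧ Y
      ⟦1+Y*⟧ [] Y = trans (+-cong (+-identityʳ 1#) (*-identityʳ Y)) (sym (*-identityʳ _))
      ⟦1+Y*⟧ (c ∷ P) Y = begin
        ι c + Y * ⟦ addConstant c (1+Y* P) ⟧ Y    ≈⟨ +-congˡ (*-congˡ (⟦addConstant⟧ c (1+Y* P) Y)) ⟩
        ι c + Y * (ι c + ⟦ 1+Y* P ⟧ Y)            ≈⟨ +-congˡ (*-congˡ (+-congˡ (trans (⟦1+Y*⟧ P Y) (expand₁ S)))) ⟩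
        ι c + Y * (ι c + (S + Y * S))             ≈⟨ regroup (ι c) Y S ⟩
        ι c + Y * S + Y * (ι c + Y * S)           ≈⟨ expand₁ _ ⟨
        (1# + Y) * (ι c + Y * S)                  ∎
        where
        open SetoidReasoning setoid
        S = ⟦ P ⟧ Y
        expand₁ : ∀ x → (1# + Y) * x ≈ x + Y * x
        expand₁ x = trans (distribʳ x 1# Y) (+-congʳ (*-identityˡ x))
        regroup : ∀ a y s → a + y * (a + (s + y * s)) ≈ a + y * s + y * (a + y * s)
        regroup = solve 3 (λ a y s → (a ⊕ (y ⊗ (a ⊕ (s ⊕ (y ⊗ s))))) ⊜ ((a ⊕ (y ⊗ s)) ⊕ (y ⊗ (a ⊕ (y ⊗ s))))) refl

      ⟦[1+Y]^⟧ : ∀ n Y → ⟦ [1+Y]^ n ⟧ Y ≈ (1# + Y) ^ n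
      ⟦[1+Y]^⟧ zero    Y = refl
      ⟦[1+Y]^⟧ (suc n) Y = trans (⟦1+Y*⟧ ([1+Y]^ n) Y) (*-congˡ (⟦[1+Y]^⟧ n Y))

      ι-+-* : ∀ d c e → ι (d ℕ.+ c ℕ.* e) ≈ ι d + ι c * ι e
      ι-+-* d c e = trans (×-homo-+ 1# d (c ℕ.* e)) (+-congˡ (×1-homo-* c e))

      ⟦addMultiple⟧ : ∀ {m n} (m<n : m ℕ.< n) c (Q : Monic m) (P : Monic n) Y →
                      ⟦ addMultiple m<n c Q P ⟧ Y ≈ ⟦ P ⟧ Y + ι c * ⟦ Q ⟧ Y
      ⟦addMultiple⟧ (s≤s _) c [] (d ∷ P) Y = begin
        ι (d ℕ.+ c ℕ.* 1) + Y * ⟦ P ⟧ Y     ≈⟨ +-congʳ (trans (ι-+-* d c 1) (+-congˡ (*-congˡ (+-identityʳ 1#)))) ⟩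
        ι d + ι c * 1# + Y * ⟦ P ⟧ Y        ≈⟨ solve 3 (λ a b c → ((a ⊕ b) ⊕ c) ⊜ ((a ⊕ c) ⊕ b)) refl (ι d) _ _ ⟩
        ι d + Y * ⟦ P ⟧ Y + ι c * 1#        ∎
        where open SetoidReasoning setoid
      ⟦addMultiple⟧ (s≤s m<n) c (e ∷ Q) (d ∷ P) Y = begin
        ι (d ℕ.+ c ℕ.* e) + Y * ⟦ addMultiple m<n c Q P ⟧ Y
          ≈⟨ +-cong (ι-+-* d c e) (*-congˡ (⟦addMultiple⟧ m<n c Q P Y)) ⟩
        ι d + ι c * ι e + Y * (⟦ P ⟧ Y + ι c * ⟦ Q ⟧ Y)
          ≈⟨ regroup (ι d) (ι c) (ι e) Y (⟦ P ⟧ Y) (⟦ Q ⟧ Y) ⟩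
        ι d + Y * ⟦ P ⟧ Y + ι c * (ι e + Y * ⟦ Q ⟧ Y) ∎
        where
        open SetoidReasoning setoid
        regroup : ∀ d c e y s t → d + c * e + y * (s + c * t) ≈ d + y * s + c * (e + y * t)
        regroup = solve 6 (λ d c e y s t → ((d ⊕ (c ⊗ e)) ⊕ (y ⊗ (s ⊕ (c ⊗ t)))) ⊜ ((d ⊕ (y ⊗ s)) ⊕ (c ⊗ (e ⊕ (y ⊗ t))))) refl

      -- After `Y ^ o` is factored out, the constant coefficient has absolute value 1 and the rest
      -- is smaller because |Y| < 1; a cofactor equal to 1 is the base case.
      order-value : ∀ {n o} {P : Monic n} → Order p-prime P o → ∀ {Y} → Y ≺ 1# →
                    ∃ λ u → ⟦ P ⟧ Y ≈ Y ^ o * u × u ≾ 1# × 1# ≾ u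
      order-value one _ = 1# , sym (*-identityˡ 1#) , ≾-refl , ≾-refl
      order-value {P = c ∷ P} (unit p∤c) {Y} Y≺1 =
        _ , sym (*-identityˡ _) , ⟦⟧-≾1 (c ∷ P) Y≺1
          , ≾-trans (1≾∧≺1⇒1≾- (1≾ι p∤c) -YS≺1) (≾-reflexive (+-congˡ (-‿involutive _)))
        where
        -YS≺1 : - (Y * ⟦ P ⟧ Y) ≺ 1#
        -YS≺1 = ≾-≺-trans (≾-neg ≾-refl)
          (≺-≾-trans (≺-*-≾ Y≺1 (⟦⟧-≾1 P Y≺1) 1≉0) (≾-reflexive (*-identityˡ 1#)))
      order-value {P = c ∷ P} (root {o = o} p∣c oP) {Y} Y≺1 with order-value oP Y≺1
      ... | u , eq , u≾1 , 1≾u = u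
        , trans (+-cong (Equivalence.from (char c) p∣c) (*-congˡ eq)) (trans (+-identityˡ _) (sym (*-assoc Y (Y ^ o) u)))
        , u≾1 , 1≾u

      -- Gaussian elimination and the adapted basis.

      record Entry : Set where
        constructor entry
        field
          {deg ord} : ℕ
          poly      : Monic deg
          isOrder   : Order p-prime poly ord
      open Entry

      -- The orders increase strictly, starting from at least l.
      data Flag (l : ℕ) : ℕ → Set where
        []    : Flag l 0
        _⟨_⟩∷_ : ∀ {m} (E : Entry) → l ℕ.≤ ord E → Flag (suc (ord E)) m → Flag l (suc m)

      member : ∀ {l m} → Flag l m → Vector Entry m
      member []            = Vector.[]
      member (E ⟨ _ ⟩∷ Es) = E Vector.∷ member Es

      ord-lower : ∀ {l m} (Es : Flag l m) j → l ℕ.≤ ord (member Es j)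
      ord-lower (E ⟨ l≤ ⟩∷ Es) zero    = l≤
      ord-lower (E ⟨ l≤ ⟩∷ Es) (suc j) = ℕ.≤-trans l≤ (ℕ.<⇒≤ (ord-lower Es j))

      ord-mono : ∀ {l m} (Es : Flag l m) {i j} → i Fin.< j → ord (member Es i) ℕ.< ord (member Es j)
      ord-mono (E ⟨ _ ⟩∷ Es) {zero}  {suc j} _         = ord-lower Es j
      ord-mono (E ⟨ _ ⟩∷ Es) {suc i} {suc j} (s≤s i<j) = ord-mono Es i<j

      expand : ∀ {m} → Vector Entry m → Vector Carrier m → Carrier → Carrier
      expand Es B Y = sum (λ j → B j * ⟦ poly (Es j) ⟧ Y)

      HasUnitAt : ∀ {m} → Vector Entry m → Vector Carrier m → ℕ → Set _
      HasUnitAt Es B n = ∃ λ j → deg (Es j) ≡ n × 1# ≾ B j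

      hasUnitAt-∷ : ∀ {m E b n} {Es : Vector Entry m} {B} → HasUnitAt Es B n → HasUnitAt (E Vector.∷ Es) (b Vector.∷ B) n
      hasUnitAt-∷ (j , eq , 1≾) = suc j , eq , 1≾

      -- The last two clauses of recoord keep track of a unit coefficient by the degree
      -- of its polynomial, since its position in the flag may change.
      record Insertion {l m} (Es : Flag l m) (E : Entry) : Set (c ⊔ ℓ ⊔ g ⊔ ℓ₂) where
        field
          flag    : Flag l (suc m)
          ord-≤   : ord (member flag zero) ℕ.≤ ord E
          deg-≤   : ∀ j → deg (member flag j) ℕ.≤ deg E
          recoord : ∀ B b → ∃ λ B′ →
            (∀ Y → expand (member flag) B′ Y ≈ b * ⟦ poly E ⟧ Y + expand (member Es) B Y) ×
            (b ≾ 1# → (∀ j → B j ≾ 1#) → ∀ j → B′ j ≾ 1#) ×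
            (1# ≾ b → HasUnitAt (member flag) B′ (deg E)) ×
            (b ≺ 1# → ∀ {n} → HasUnitAt (member Es) B n → HasUnitAt (member flag) B′ n)

      -- When the order of `E` is already taken by `E′`, a multiple of `E′` is added to `E`. This
      -- raises the order of `E` and, as `E′` has smaller degree, keeps its degree; the new entry is
      -- inserted further down.
      insert : ∀ {l m} (Es : Flag l m) (E : Entry) → l ℕ.≤ ord E →
               (∀ j → deg (member Es j) ℕ.< deg E) → Insertion Es E
      insert [] E l≤ _ = record
        { flag = E ⟨ l≤ ⟩∷ []
        ; ord-≤ = ℕ.≤-refl
        ; deg-≤ = λ { zero → ℕ.≤-refl }
        ; recoord = λ B b → b Vector.∷ Vector.[] , (λ _ → refl) , (λ { b≾1 _ zero → b≾1 })
                          , (λ 1≾b → zero , ≡.refl , 1≾b) , λ { _ (() , _) }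
        }
      insert (E′ ⟨ l≤′ ⟩∷ Es) E l≤ deg< with ℕ.<-cmp (ord E) (ord E′)
      ... | tri< o<o′ _ _ = record
        { flag = E ⟨ l≤ ⟩∷ (E′ ⟨ o<o′ ⟩∷ Es)
        ; ord-≤ = ℕ.≤-refl
        ; deg-≤ = λ { zero → ℕ.≤-refl ; (suc j) → ℕ.<⇒≤ (deg< j) }
        ; recoord = λ B b → b Vector.∷ B , (λ _ → refl)
                          , (λ { b≾1 B≾1 zero → b≾1 ; b≾1 B≾1 (suc j) → B≾1 j })
                          , (λ 1≾b → zero , ≡.refl , 1≾b) , λ _ → hasUnitAt-∷
        }
      ... | tri> _ _ o′<o with ih ← insert Es E o′<o (deg< ∘ suc) = record
        { flag = E′ ⟨ l≤′ ⟩∷ Insertion.flag ih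
        ; ord-≤ = ℕ.<⇒≤ o′<o
        ; deg-≤ = λ { zero → ℕ.<⇒≤ (deg< zero) ; (suc j) → Insertion.deg-≤ ih j }
        ; recoord = λ B b → let B′ , eq , B′≾1 , new , old = Insertion.recoord ih (B ∘ suc) b in
            B zero Vector.∷ B′
            , (λ Y → trans (+-congˡ (eq Y)) (solve 3 (λ x y z → (x ⊕ (y ⊕ z)) ⊜ (y ⊕ (x ⊕ z))) refl _ _ _))
            , (λ { b≾1 B≾1 zero → B≾1 zero ; b≾1 B≾1 (suc j) → B′≾1 b≾1 (B≾1 ∘ suc) j })
            , hasUnitAt-∷ ∘ new
            , λ { b≺1 (zero , eq , 1≾) → zero , eq , 1≾
                ; b≺1 (suc j , eq , 1≾) → hasUnitAt-∷ (old b≺1 (j , eq , 1≾)) }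
        }
      ... | tri≈ _ o≡o′ _
        with c , o″ , o<o″ , isO ← raiseOrder p-prime (deg< zero) (isOrder E)
                                      (≡.subst (Order p-prime (poly E′)) (≡.sym o≡o′) (isOrder E′))
        with ih ← insert Es (entry (addMultiple (deg< zero) c (poly E′) (poly E)) isO)
                    (≡.subst (ℕ._< o″) o≡o′ o<o″) (deg< ∘ suc) = record
        { flag = E′ ⟨ l≤′ ⟩∷ Insertion.flag ih
        ; ord-≤ = ℕ.≤-reflexive (≡.sym o≡o′)
        ; deg-≤ = λ { zero → ℕ.<⇒≤ (deg< zero) ; (suc j) → Insertion.deg-≤ ih j }
        ; recoord = λ B b → let B′ , eq , B′≾1 , new , old = Insertion.recoord ih (B ∘ suc) b in
            -- Writing `E = (E + c E′) - c E′` passes `b` to the new entry and lowers the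
            -- coefficient of `E′` by `b c`.
            (B zero - b * ι c) Vector.∷ B′
            , (λ Y → trans
                       (+-congˡ (trans (eq Y) (+-congʳ (*-congˡ (⟦addMultiple⟧ (deg< zero) c (poly E′) (poly E) Y)))))
                       (exchange (B zero) b (ι c) _ _ _))
            , (λ { b≾1 B≾1 zero → ≾-+ (B≾1 zero) (≾-neg (bι≾ b c b≾1))
                 ; b≾1 B≾1 (suc j) → B′≾1 b≾1 (B≾1 ∘ suc) j })
            , hasUnitAt-∷ ∘ new
            -- The correction `b c` is smaller than 1, so a unit coefficient at `E′` stays a unit.
            , λ { b≺1 (zero , eq , 1≾) → zero , eq ,
                    1≾∧≺1⇒1≾- 1≾ (≺-≾-trans (≺-*-≾ b≺1 (ι≾1 c) 1≉0) (≾-reflexive (*-identityˡ 1#)))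
                ; b≺1 (suc j , eq , 1≾) → hasUnitAt-∷ (old b≺1 (j , eq , 1≾)) }
        }
        where
        bι≾ : ∀ b c → b ≾ 1# → b * ι c ≾ 1#
        bι≾ b c b≾1 = ≾-trans (≾-* b≾1 (ι≾1 c)) (≾-reflexive (*-identityˡ 1#))

        exchange : ∀ x b c P Q z → (x - b * c) * Q + (b * (P + c * Q) + z) ≈ b * P + (x * Q + z)
        exchange x b c P Q z = begin
          (x - bc) * Q + (b * (P + c * Q) + z)
            ≈⟨ +-cong (distribʳ Q x (- bc)) (+-congʳ (trans (distribˡ b P (c * Q)) (+-congˡ (sym (*-assoc b c Q))))) ⟩
          (x * Q + (- bc) * Q) + ((b * P + bc * Q) + z)
            ≈⟨ solve 5 (λ u v w y z → ((u ⊕ v) ⊕ ((w ⊕ y) ⊕ z)) ⊜ ((v ⊕ y) ⊕ (w ⊕ (u ⊕ z)))) refl _ _ _ _ _ ⟩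
          ((- bc) * Q + bc * Q) + (b * P + (x * Q + z))
            ≈⟨ +-congʳ (trans (sym (distribʳ Q (- bc) bc)) (trans (*-congʳ (-‿inverseˡ bc)) (zeroˡ Q))) ⟩
          0# + (b * P + (x * Q + z))
            ≈⟨ +-identityˡ _ ⟩
          b * P + (x * Q + z) ∎
          where
          open SetoidReasoning setoid
          bc = b * c

      record Basis {m} (n : Vector ℕ m) : Set (c ⊔ ℓ ⊔ g ⊔ ℓ₂) where
        field
          flag    : Flag 0 m
          deg-<   : ∀ {N} → (∀ i → n i ℕ.< N) → ∀ j → deg (member flag j) ℕ.< N
          head    : ∀ j → toℕ j ≡ 0 → ord (member flag j) ≡ 0
          recoord : ∀ (b : Vector Carrier m) → ∃ λ (B : Vector Carrier m) →
            (∀ Y → expand (member flag) B Y ≈ sum (λ i → b i * (1# + Y) ^ n i)) ×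
            ((∀ i → b i ≾ 1#) → ∀ j → B j ≾ 1#) ×
            (∀ i → 1# ≾ b i → (∀ h → h Fin.< i → b h ≺ 1#) → HasUnitAt (member flag) B (n i))

      -- The smallest exponent is inserted first, so every new power has degree above all members so
      -- far. The powers inserted after `n i` have index `h < i`; their coefficients, smaller than
      -- 1, preserve the unit in degree `n i`.
      basis : ∀ {m} (n : Vector ℕ m) → (∀ {i j} → i Fin.< j → n j ℕ.< n i) → Basis n
      basis {zero}  n _ = record
        { flag = [] ; deg-< = λ _ () ; head = λ ()
        ; recoord = λ _ → Vector.[] , (λ _ → refl) , (λ _ ()) , λ () }
      basis {suc m} n desc = record
        { flag = I.flag
        ; deg-< = λ n< j → ℕ.≤-<-trans (I.deg-≤ j) (n< zero)
        -- The power of `1 + Y` inserted last has order 0, and the first order does not exceed it.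
        ; head = λ { zero _ → ℕ.n≤0⇒n≡0 I.ord-≤ }
        ; recoord = λ b → let B , eq , B≾1 , unitAt = T.recoord (b ∘ suc)
                              B′ , eq′ , B′≾1 , new , old = I.recoord B (b zero) in
            B′
            , (λ Y → trans (eq′ Y) (+-cong (*-congˡ (⟦[1+Y]^⟧ (n zero) Y)) (eq Y)))
            , (λ b≾1 → B′≾1 (b≾1 zero) (B≾1 (b≾1 ∘ suc)))
            , λ { zero 1≾b _ → new 1≾b
                ; (suc i) 1≾b b≺1 → old (b≺1 zero (s≤s z≤n)) (unitAt i 1≾b λ h h<i → b≺1 (suc h) (s≤s h<i)) }
        }
        where
        module T = Basis (basis (n ∘ suc) (desc ∘ s≤s))
        module I = Insertion (insert T.flag (entry ([1+Y]^ (n zero)) (order-[1+Y]^ p-prime (n zero))) z≤n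
                               (T.deg-< λ i → desc (s≤s z≤n)))

      -- Labels and the Newton polygon of `f`.

      module SparsePolynomial {k} (a : Vector Carrier (suc k)) (n : Vector ℕ (suc k))
                              (a≉0 : ∀ i → a i ≉ 0#)
                              (n-desc : ∀ {i j} → i Fin.< j → n j ℕ.< n i) where

        open Basis (basis n n-desc) using (flag; head; recoord)

        private
          E = member flag
          f = eval K a n
          S = IsZero K a n

        record Label (z : Carrier) (j : Fin (suc k)) : Set (c ⊔ ℓ ⊔ g ⊔ ℓ₂) where
          field
            lead       : Fin (suc k)
            lead-max   : ∀ h → a h * z ^ n h ≾ a lead * z ^ n lead
            lead-first : ∀ h → h Fin.< lead → a h * z ^ n h ≺ a lead * z ^ n lead
            deg-lead   : deg (E j) ≡ n lead
            {scale}    : Carrier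
            B          : Vector Carrier (suc k)
            expansion  : ∀ Y → expand E B Y ≈ scale * f (z * (1# + Y))
            B≾1        : ∀ h → B h ≾ 1#
            1≾Bj       : 1# ≾ B j

        f-cong : ∀ {x y} → x ≈ y → f x ≈ f y
        f-cong x≈y = sum-cong-≋ λ i → *-congˡ {x = a i} (^-congˡ (n i) x≈y)

        label : ∀ {z} → z ≉ 0# → ∃ (Label z)
        label {z} z≉0 with firstMax (λ h → a h * z ^ n h)
        ... | lead , max , first = unit-index , record
          { lead = lead ; lead-max = max ; lead-first = first
          ; deg-lead = proj₁ (proj₂ unitAt) ; B = B
          ; expansion = λ Y → trans (B-eval Y) (rescale Y)
          ; B≾1 = B≾1 λ h → ≾-trans (≾-* (max h) ≾-refl) (≾-reflexive (inv-* t≉0))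
          ; 1≾Bj = proj₂ (proj₂ unitAt) }
          where
          t : Vector Carrier (suc k)
          t h = a h * z ^ n h
          t≉0 : t lead ≉ 0#
          t≉0 = *-≉0 (a≉0 lead) (^-≉0 (n lead) z≉0)
          s = inv t≉0
          b : Vector Carrier (suc k)
          b h = t h * s
          B      = proj₁ (recoord b)
          B-eval = proj₁ (proj₂ (recoord b))
          B≾1    = proj₁ (proj₂ (proj₂ (recoord b)))
          unitAt : HasUnitAt E B (n lead)
          unitAt = proj₂ (proj₂ (proj₂ (recoord b))) lead
            (≾-reflexive (sym (inv-* t≉0)))
            (λ h h<lead → ≺-≾-trans (≺-*ʳ (inv≉0 t≉0) (first h h<lead)) (≾-reflexive (inv-* t≉0)))
          unit-index = proj₁ unitAt

          rescale : ∀ Y → sum (λ h → b h * (1# + Y) ^ n h) ≈ s * f (z * (1# + Y))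
          rescale Y = sym (trans (*-distribˡ-sum s (λ h → a h * (z * (1# + Y)) ^ n h)) (sum-cong-≋ term))
            where
            term : ∀ h → s * (a h * (z * (1# + Y)) ^ n h) ≈ b h * (1# + Y) ^ n h
            term h = begin
              s * (a h * (z * (1# + Y)) ^ n h)            ≈⟨ *-congˡ (*-congˡ (^-distrib-* z (1# + Y) (n h))) ⟩
              s * (a h * (z ^ n h * (1# + Y) ^ n h))      ≈⟨ *-congˡ (*-assoc (a h) _ _) ⟨
              s * (a h * z ^ n h * (1# + Y) ^ n h)        ≈⟨ *-assoc s _ _ ⟨
              s * (a h * z ^ n h) * (1# + Y) ^ n h        ≈⟨ *-congʳ (*-comm s _) ⟩
              b h * (1# + Y) ^ n h                        ∎
              where open SetoidReasoning setoid

        n-injective : ∀ {i j} → n i ≡ n j → i ≡ j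
        n-injective {i} {j} eq with Fin.<-cmp i j
        ... | tri< i<j _ _ = contradiction (≡.sym eq) (ℕ.<⇒≢ (n-desc i<j))
        ... | tri≈ _ i≡j _ = i≡j
        ... | tri> _ _ j<i = contradiction eq (ℕ.<⇒≢ (n-desc j<i))

        -- Suppose |y| < |z|. The zero `z` has a second maximal term, whose exponent is smaller
        -- because the lead is the first maximal term. At `y` that term strictly exceeds the lead,
        -- but equal labels make the lead maximal at `y` too.
        label-≾ : ∀ {y z j} → y ≉ 0# → z ≉ 0# → S z → Label y j → Label z j → z ≾ y
        label-≾ {y} {z} y≉0 z≉0 fz≈0 Ly Lz with compare card z y
        ... | inj₁ z≾y = z≾y
        ... | inj₂ y≺z with h , h≢ , ≾h ← second-max (λ h → a h * z ^ n h) fz≈0 (Label.lead Lz)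
                                              (*-≉0 (a≉0 _) (^-≉0 (n (Label.lead Lz)) z≉0))
                       with Fin.<-cmp h (Label.lead Lz)
        ...   | tri< h<lead _ _ = ⊥-elim (proj₂ (Label.lead-first Lz h h<lead) ≾h)
        ...   | tri≈ _ h≡lead _ = contradiction h≡lead h≢
        ...   | tri> _ _ lead<h = ⊥-elim (proj₂ (shrink y≉0 y≺z (n-desc lead<h) (a≉0 h) ≾h)
                  (≡.subst (λ i → a h * y ^ n h ≾ a i * y ^ n i) lead≡ (Label.lead-max Ly h)))
          where
          lead≡ : Label.lead Ly ≡ Label.lead Lz
          lead≡ = n-injective (≡.trans (≡.sym (Label.deg-lead Ly)) (Label.deg-lead Lz))

        -- The Newton polygon in `Y` at a zero `r`.

        module _ {r j} (r≉0 : r ≉ 0#) (fr≈0 : S r) (L : Label r j) where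
          open Label L

          vanish : ∀ {y} Y → r * (1# + Y) ≈ y → S y → expand E B Y ≈ 0#
          vanish Y eq fy≈0 = trans (expansion Y) (trans (*-congˡ (trans (f-cong eq) fy≈0)) (zeroʳ scale))

          -- At `Y = 0` every later member vanishes, having positive order, while the first takes a
          -- unit value; the expansion is 0 there because `r` is a zero.
          B₀≈0 : B zero ≈ 0#
          B₀≈0 with order-value (isOrder (E zero)) (0≺ 1≉0)
          ... | u , eq , u≾1 , 1≾u = ≾0⇒≈0 (≾-trans (≾-trans (≾-reflexive (sym (*-identityʳ _)))
                  (≾-* ≾-refl (≾-trans 1≾u (≾-reflexive (sym value₀)))))
                (≾-trans (≾-reflexive (+-inverseˡ-unique _ _ (vanish 0# (trans (*-congˡ (+-identityʳ 1#)) (*-identityʳ r)) fr≈0)))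
                  (≾-neg (sum-≾ _ λ h → ≾-reflexive (trans (*-congˡ (value₊ h)) (zeroʳ _))))))
            where
            value₀ : ⟦ poly (E zero) ⟧ 0# ≈ u
            value₀ = trans eq (trans (*-congʳ (reflexive (cong (0# ^_) (head zero ≡.refl)))) (*-identityˡ u))
            value₊ : ∀ h → ⟦ poly (E (suc h)) ⟧ 0# ≈ 0#
            value₊ h with ord (E (suc h)) | ord-mono flag {zero} {suc h} (s≤s z≤n) | order-value (isOrder (E (suc h))) (0≺ 1≉0)
            ... | suc o | _ | _ , eq , _ = trans eq (trans (*-congʳ (zeroˡ _)) (zeroˡ _))

          -- Only the later terms are compared: a smaller |Y| can only favour earlier ones.
          Dominates : Carrier → Fin (suc k) → Set _
          Dominates β i = B i ≉ 0# × (∀ h → i Fin.< h → B h * β ^ ord (E h) ≾ B i * β ^ ord (E i))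

          dominates⇒>0 : ∀ {β} i → Dominates β i → 1 ℕ.≤ toℕ i
          dominates⇒>0 zero    (B≉0 , _) = contradiction B₀≈0 B≉0
          dominates⇒>0 (suc i) _         = s≤s z≤n

          -- Each term has absolute value |B h| |Y|^ord. Passing from β to the smaller `Y` makes all
          -- terms after `i` strictly smaller than term `i`, and a vanishing sum attains its maximum
          -- twice, so some maximal term comes before `i`.
          descend : ∀ {β Y i} → β ≾ 1# → Y ≉ 0# → Y ≺ β → expand E B Y ≈ 0# →
                    Dominates β i → ∃ λ i′ → i′ Fin.< i × Dominates Y i′
          descend {β} {Y} {i} β≾1 Y≉0 Y≺β sum≈0 (Bi≉0 , dom) = conclude
            where
            Y≺1 = ≺-≾-trans Y≺β β≾1

            T T′ : Vector Carrier (suc k)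
            T  h = B h * ⟦ poly (E h) ⟧ Y
            T′ h = B h * Y ^ ord (E h)

            T≾T′ : ∀ h → T h ≾ T′ h
            T≾T′ h with u , eq , u≾1 , _ ← order-value (isOrder (E h)) Y≺1 =
              ≾-* ≾-refl (≾-trans (≾-reflexive eq) (≾-trans (≾-* ≾-refl u≾1) (≾-reflexive (*-identityʳ _))))

            T′≾T : ∀ h → T′ h ≾ T h
            T′≾T h with u , eq , _ , 1≾u ← order-value (isOrder (E h)) Y≺1 =
              ≾-* ≾-refl (≾-trans (≾-trans (≾-reflexive (sym (*-identityʳ _))) (≾-* ≾-refl 1≾u)) (≾-reflexive (sym eq)))

            Ti≉0 : T i ≉ 0#
            Ti≉0 = ≿⇒≉0 (*-≉0 Bi≉0 (^-≉0 (ord (E i)) Y≉0)) (T′≾T i)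

            later : ∀ {h} → i Fin.< h → ¬ T i ≾ T h
            later {h} i<h Ti≾Th = proj₂ (shrink Y≉0 Y≺β (ord-mono flag i<h) Bi≉0 (dom h i<h))
              (≾-trans (T′≾T i) (≾-trans Ti≾Th (T≾T′ h)))

            dominates : ∀ {h} → T i ≾ T h → (∀ x → T x ≾ T h) → Dominates Y h
            dominates {h} Ti≾Th max =
              (λ Bh≈0 → ≿⇒≉0 Ti≉0 Ti≾Th (trans (*-congʳ Bh≈0) (zeroˡ _)))
              , λ x _ → ≾-trans (T′≾T x) (≾-trans (max x) (T≾T′ h))

            conclude : ∃ λ i′ → i′ Fin.< i × Dominates Y i′
            conclude with firstMax T
            ... | M , max , _ with Fin.<-cmp M i
            ...   | tri< M<i _ _ = M , M<i , dominates (max i) max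
            ...   | tri> _ _ i<M = ⊥-elim (later i<M (max i))
            ...   | tri≈ _ ≡.refl _ with second-max T sum≈0 i Ti≉0
            ...     | h , h≢i , Ti≾Th with Fin.<-cmp h i
            ...       | tri< h<i _ _ = h , h<i , dominates Ti≾Th (λ x → ≾-trans (max x) Ti≾Th)
            ...       | tri≈ _ h≡i _ = contradiction h≡i h≢i
            ...       | tri> _ _ i<h = ⊥-elim (later i<h Ti≾Th)

          -- Every tooth `y = r (1 + Y)` is a zero and lowers the dominating index, which stays
          -- positive because the coefficient at index 0 vanishes.
          comb-< : ∀ {β i ys} → β ≾ 1# → Dominates β i → Comb S r (r * β) ys → length ys ℕ.< toℕ i
          comb-< β≾1 dom [] = dominates⇒>0 _ dom
          comb-< {β} β≾1 dom (tooth {y = y} fy≈0 y-r≉0 y-r≺ cs) =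
            let _ , i′<i , dom′ = descend β≾1 (*-≉0 y-r≉0 (inv≉0 r≉0)) Y≺β
                  (vanish Y r[1+Y]≈y fy≈0) dom
            in ℕ.≤-trans (s≤s (comb-< (≾-trans (≺⇒≾ Y≺β) β≾1) dom′ (comb-≾ (≾-reflexive (sym rY≈y-r)) cs))) i′<i
            where
            Y = (y - r) * inv r≉0
            rY≈y-r : r * Y ≈ y - r
            rY≈y-r = trans (*-comm r Y) (inv-*-cancel r≉0 (y - r))
            Y≺β : Y ≺ β
            Y≺β = ≺-≾-trans (≺-*ʳ (inv≉0 r≉0) y-r≺)
              (≾-reflexive (trans (*-congʳ (*-comm r β)) (*-inv-cancel r≉0 β)))
            r[1+Y]≈y : r * (1# + Y) ≈ y
            r[1+Y]≈y = begin
              r * (1# + Y)      ≈⟨ distribˡ r 1# Y ⟩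
              r * 1# + r * Y    ≈⟨ +-cong (*-identityʳ r) rY≈y-r ⟩
              r + (y - r)       ≈⟨ +-comm r (y - r) ⟩
              y - r + r         ≈⟨ +-assoc y (- r) r ⟩
              y + (- r + r)     ≈⟨ +-congˡ (-‿inverseˡ r) ⟩
              y + 0#            ≈⟨ +-identityʳ y ⟩
              y                 ∎
              where open SetoidReasoning setoid

          -- The descent starts at β = 1, where the unit coefficient at `j` dominates since no
          -- coefficient exceeds 1.
          comb-<label : ∀ {ys} → Comb S r r ys → length ys ℕ.< toℕ j
          comb-<label cs = comb-< ≾-refl
            ( ≿⇒≉0 1≉0 1≾Bj
            , λ h _ → ≾-trans (1^-≾ (ord (E h)) (B h)) (≾-trans (≾-trans (B≾1 h) 1≾Bj) (1≾1^ (ord (E j)) (B j))))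
            (comb-≾ (≾-reflexive (sym (*-identityʳ r))) cs)

        -- Counting the zeros label by label.

        LabelledBy : Carrier → ℕ → Set (c ⊔ ℓ ⊔ g ⊔ ℓ₂)
        LabelledBy z m = z ≈ 0# × m ≡ 0 ⊎ z ≉ 0# × ∃ λ j → toℕ j ≡ m × Label z j

        labelled : ∀ z → ∃ λ m → m ℕ.< suc k × LabelledBy z m
        labelled z with z ≈0?
        ... | yes z≈0 = 0 , s≤s z≤n , inj₁ (z≈0 , ≡.refl)
        ... | no  z≉0 = let j , L = label z≉0 in toℕ j , Fin.toℕ<n j , inj₂ (z≉0 , j , ≡.refl , L)

        -- Even the empty comb is strictly shorter than the label of a nonzero zero; label 0 is thus
        -- reserved for the point 0.
        labelled-0 : ∀ {z} → S z → LabelledBy z 0 → z ≈ 0#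
        labelled-0 fz≈0 (inj₁ (z≈0 , _))            = z≈0
        labelled-0 {z} fz≈0 (inj₂ (z≉0 , zero , _ , L)) = ⊥-elim (ℕ.n≮0 (comb-<label {z} {zero} z≉0 fz≈0 L {ys = []} []))

        labelled-suc : ∀ {z e} → LabelledBy z (suc e) → z ≉ 0# × ∃ λ j → toℕ j ≡ suc e × Label z j
        labelled-suc (inj₂ p) = p

        -- All these zeros have the same absolute value |z₀|; they lie in the q − 1
        -- nonzero residue classes of the disc |z| ≤ |z₀|.
        atMost-labelled : ∀ m → AtMost setoid (geometricWeight q′ m) (λ z → S z × LabelledBy z m)
        atMost-labelled zero [] _ _ = z≤n
        atMost-labelled zero (_ ∷ []) _ _ = s≤s z≤n
        atMost-labelled zero (y ∷ z ∷ _) ((y≉z ∷ _) ∷ _) ((fy , Ly) ∷ (fz , Lz) ∷ _) =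
          contradiction (trans (labelled-0 fy Ly) (sym (labelled-0 fz Lz))) y≉z
        atMost-labelled (suc e) [] _ _ = z≤n
        atMost-labelled (suc e) xs@(w ∷ ws) uniq pxs
          with z₀ , z₀∈ , max ← ⊑-max (λ z → z) w ws = ≡.subst (length xs ℕ.≤_) (sumBelow-const (q ℕ.^ e) q′)
            (atMost-fibres setoid {P = P} Class (λ _ → q ℕ.^ e) q′ classify
              (λ {c} _ → combs-bounded e z₀ (λ z → P z × Class z c)
                (proj₁ ∘ proj₁ ∘ proj₁) same-class short)
              xs uniq (All.zip (pxs , max)))
          where
          P : Pred Carrier _
          P z = (S z × LabelledBy z (suc e)) × z ⊑ z₀

          z₀-props : S z₀ × LabelledBy z₀ (suc e)
          z₀-props = All.lookup pxs z₀∈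

          z₀≉0 : z₀ ≉ 0#
          z₀≉0 = proj₁ (labelled-suc (proj₂ z₀-props))

          z₀≾ : ∀ {z} → P z → z₀ ≾ z
          z₀≾ ((_ , Lz) , _) with labelled-suc Lz | labelled-suc (proj₂ z₀-props)
          ... | z≉0 , i , i≡ , Li | _ , j , j≡ , Lj with ≡.refl ← Fin.toℕ-injective (≡.trans i≡ (≡.sym j≡)) =
            label-≾ z≉0 z₀≉0 (proj₁ z₀-props) Li Lj

          z-0≈z : ∀ z → z - 0# ≈ z
          z-0≈z z = trans (+-congˡ -0#≈0#) (+-identityʳ z)

          zero-class : Fin q
          zero-class = residue card z₀≉0 {0# - 0#} (≈0⇒⊑ z₀ (z-0≈z 0#))

          -- `punchIn` skips the residue class of 0 and numbers the other `q′` classes.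
          Class : Carrier → ℕ → Set _
          Class z c = ∃ λ i → toℕ i ≡ c × ResidueClass z₀≉0 0# z (toℕ (punchIn zero-class i))

          classify : ∀ {z} → P z → ∃ λ c → c ℕ.< q′ × Class z c
          classify {z} pz@(_ , z⊑z₀) = toℕ i , Fin.toℕ<n i , i , ≡.refl , z-0⊑z₀ ,
            cong toℕ (≡.sym (Fin.punchIn-punchOut nonzero))
            where
            z-0⊑z₀ : z - 0# ⊑ z₀
            z-0⊑z₀ = ⊑-trans (⊑-reflexive (z-0≈z z)) z⊑z₀
            nonzero : zero-class ≢ residue card z₀≉0 z-0⊑z₀
            nonzero eq = proj₂ (residueClass-≺ z₀≉0 {0#} {z} {0#} (z-0⊑z₀ , cong toℕ (≡.sym eq)) (_ , ≡.refl))
              (≾-trans (z₀≾ pz) (≾-reflexive (sym (z-0≈z z))))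
            i = punchOut nonzero

          same-class : ∀ {c y z} → P y × Class y c → P z × Class z c → y - z ≺ z₀
          same-class (_ , i , i≡ , cy) (_ , j , j≡ , cz)
            with ≡.refl ← Fin.toℕ-injective (≡.trans i≡ (≡.sym j≡)) = residueClass-≺ z₀≉0 cy cz

          short : ∀ {c z ys} → P z × Class z c → Comb S z z₀ ys → length ys ℕ.≤ e
          short {ys = ys} (pz@((fz , Lz) , _) , _) cs with labelled-suc Lz
          ... | z≉0 , j , j≡ , L = s≤s⁻¹ (≡.subst (length ys ℕ.<_) j≡ (comb-<label z≉0 fz L (comb-≾ (z₀≾ pz) cs)))

        zeros-bound : AtMost setoid (q ℕ.^ k) S
        zeros-bound = ≡.subst (λ N → AtMost setoid N S) (sumBelow-geometric q′ k)
          (atMost-fibres setoid LabelledBy (geometricWeight q′) (suc k) (λ {z} _ → labelled z) λ {m} _ → atMost-labelled m)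

-- Sorting the exponents.

maximum : ∀ {k} (n : Vector ℕ (suc k)) → ∃ λ i → ∀ h → n h ℕ.≤ n i
maximum {zero}  n = zero , λ { zero → ℕ.≤-refl }
maximum {suc k} n with maximum (n ∘ suc)
... | i , max with ℕ.≤-total (n zero) (n (suc i))
...   | inj₁ p = suc i , λ { zero → p ; (suc h) → max h }
...   | inj₂ p = zero  , λ { zero → ℕ.≤-refl ; (suc h) → ℕ.≤-trans (max h) p }

sortDescending : ∀ {k} (n : Vector ℕ k) → Injective _≡_ _≡_ n →
                 ∃ λ (π : Permutation k k) → ∀ {i j} → i Fin.< j → n (π ⟨$⟩ʳ j) ℕ.< n (π ⟨$⟩ʳ i)
sortDescending {zero}  n inj = Permutation.id , λ { {()} }
sortDescending {suc k} n inj with maximum n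
... | top , max with sortDescending (n ∘ punchIn top) (Fin.punchIn-injective top _ _ ∘ inj)
...   | π , desc = Permutation.insert zero top π , sorted
  where
  π-suc : ∀ j → Permutation.insert zero top π ⟨$⟩ʳ suc j ≡ punchIn top (π ⟨$⟩ʳ j)
  π-suc = Permutation.insert-punchIn zero top π
  sorted : ∀ {i j} → i Fin.< j →
           n (Permutation.insert zero top π ⟨$⟩ʳ j) ℕ.< n (Permutation.insert zero top π ⟨$⟩ʳ i)
  sorted {zero}  {suc j} _ rewrite π-suc j =
    ℕ.≤∧≢⇒< (max _) (Fin.punchInᵢ≢i top _ ∘ inj)
  sorted {suc i} {suc j} (s≤s i<j) rewrite π-suc i | π-suc j = desc i<j

-- The bound for exponents in any order.

open import Data.Nat.Base using (_^_)

theorem1 : ∀ {c ℓ g ℓ₁ ℓ₂} (p : ℕ) → Prime p →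
    (K : Field c ℓ) → HasCharacteristic K p →
    (G : OrderedAbelianGroup g ℓ₁ ℓ₂) (V : Valuation K G) →
    (q : ℕ) → HasCardinality (residueSetoid V) q →
    (k : ℕ) (a : Fin (suc k) → Field.Carrier K) (n : Fin (suc k) → ℕ) →
    (∀ i → Field._≉_ K (a i) (Field.0# K)) →
    Injective _≡_ _≡_ n →
    AtMost (Field.setoid K) (q ^ k) (IsZero K a n)
-- The residue class of 1 would be an element of `Fin 0`.
theorem1 p p-prime K char G V zero card k a n a≉0 n-inj = ⊥-elim (Fin.¬Fin0 (residue card 1≉0 (⊑-reflexive refl)))
  where
  open Field K using (1≉0; refl)
  open AbsoluteValue V
theorem1 p p-prime K char G V (suc q′) card k a n a≉0 n-inj xs uniq zeros
  with π , desc ← sortDescending n n-inj =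
  -- Permuting the terms does not change the value of the polynomial, so the zeros carry over to the
  -- sorted one.
  zeros-bound xs uniq (All.map (λ {x} → trans (sym (sum-permute (λ i → a i * pow x (n i)) π))) zeros)
  where
  open Field K using (semiring; commutativeSemiring; trans; sym; _*_)
  open Exp commutativeSemiring using () renaming (_^_ to pow)
  open SemiringSum semiring using (sum-permute)
  open AbsoluteValue V
  open DecidableValue card
  open Characteristic p-prime char
  open SparsePolynomial (a ∘ (π ⟨$⟩ʳ_)) (n ∘ (π ⟨$⟩ʳ_)) (a≉0 ∘ (π ⟨$⟩ʳ_)) desc
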